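{- As $n\to\infty$ over powers of two, there is a single real polynomial, in the $2n^2$ bits of $x$ and the $(1+M)\log n$ descriptor bits of $(j,A)$, of degree $O(\sqrt{n+L}\,\log^3 n)=\widetilde{O}(\sqrt n)$ that $\tfrac13$-approximates the predicate $\varphi_0$ defined in the context (i.e. differs from $\varphi_0$ by at most $\tfrac13$ at every Boolean input); hence $\widetilde{\deg}(\varphi_0)=\widetilde{O}(\sqrt n)$.
   Context: Parameters. $n=2^\ell$ is a power of two, large enough that $\ell=\log_2 n\ge5$; $M:=\lfloor n^{(\ell+1)/(\ell+2)}\rfloor$ (so $1\le M<n$) and $L:=\ell n$. Fix a bijection between $\{0,1\}^\ell$ and $[n]=\{1,\dots,n\}$, so that each $\ell$-bit string names an element of $[n]$. Fix maps $r_1,\dots,r_\ell:[n]\times[n]\to[n]$ with the property (such maps exist) that for every $S\subseteq[n]$ with $|S|\le n^{(\ell+1)/(\ell+2)}$, $|\{(i,j)\in S\times S:\ r_k(i,j)\in S\ \forall k\in[\ell]\}|\le L$. Inputs. $x\in\{0,1\}^{2n^2}$ has coordinates $x_{i,j,b}$, $i,j\in[n]$, $b\in\{1,2\}$. Membership. For a list $A=(a_1,\dots,a_M)\in[n]^M$ (not necessarily sorted) and $i\in[n]$, $\operatorname{mem}_A(i)\in\{0,1\}$ is the output of this search: start with $\lambda=1,\mu=M+1$; while $\lambda<\mu$, let $m=\lfloor(\lambda+\mu)/2\rfloor$, and if $a_m<i$ set $\lambda:=m+1$, else set $\mu:=m$; at the end output $1$ iff $\lambda\le M$ and $a_\lambda=i$.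 Descriptors and validity. A canonical $0$-certificate descriptor is a pair $(j,A)$ with $j\in[n]$, $A\in[n]^M$, encoded by $(1+M)\log n$ bits. For $u\ne v$ let $E_A(u,v)=\operatorname{mem}_A(u)\operatorname{mem}_A(v)\prod_{k=1}^\ell\operatorname{mem}_A(r_k(u,v))$, $Z_{u,v}=(1-x_{u,v,1})(1-x_{v,v,2})$, and $W(A,x)=\sum_{u\neq v}E_A(u,v)(1-Z_{u,v})$, the sum over ordered pairs of distinct $u,v\in[n]$. The descriptor $(j,A)$ is valid on $x$ if (K) for all $i\in[n]$, $\operatorname{mem}_A(i)=1$ or $(x_{i,j,1},x_{i,j,2})=(0,0)$; and (R) $W(A,x)=0$. The total predicate $\varphi_0(x,(j,A))$ equals $1$ iff $(j,A)$ is valid on $x$, and $0$ otherwise. For a total Boolean function $g$ on $\{0,1\}^N$, $\widetilde{\deg}(g)$ is the least degree of a real polynomial $p$ with $|p(x)-g(x)|\le1/3$ for all $x\in\{0,1\}^N$. $\widetilde O$ suppresses factors polylogarithmic in $n$; logarithms are base $2$. -}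

module Defs where

open import Data.Bool.Base using (Bool; true; false; if_then_else_; _∧_)
open import Data.Bool.Properties using () renaming (_≟_ to _≟ᵇ_)
open import Data.Fin.Base using (Fin; zero; suc; combine; _↑ˡ_; _↑ʳ_)
open import Data.Fin.Properties using (all?) renaming (_≟_ to _≟ᶠ_; _<?_ to _<ᶠ?_)
open import Data.Fin.Subset using (Subset; _∈_; ∣_∣)
open import Data.Fin.Subset.Properties using (_∈?_)
open import Data.List.Base using (List; []; _∷_; map; filter; length; allFin; cartesianProduct)
open import Data.Maybe.Base using (Maybe; just; nothing)
open import Data.Nat.Base using (ℕ; zero; suc; _+_; _*_; _^_; _∸_; _≤_; _<_; ⌊_/2⌋; _⊔_)
open import Data.Nat.Induction using (<-rec)
open import Data.Nat.ListAction using (sum; product)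
open import Data.Nat.Properties using (_≤?_; _<?_; _≟_; ≮⇒≥; ≤-trans; m≤m⊔n; m≤n⊔m; ≤-refl)
open import Data.Integer.Base using (+_)
open import Data.Product.Base using (∃-syntax; _×_; _,_; proj₁; proj₂)
open import Data.Rational.Base as ℚ using (ℚ; 0ℚ; 1ℚ; ½; Positive)
open import Data.Rational.Properties as ℚₚ using ()
open import Data.Rational.Solver using (module +-*-Solver)
open import Data.Sum.Base using (_⊎_)
open import Data.Vec.Base as Vec using (Vec; []; _∷_; lookup; tabulate)
open import Data.Vec.Properties using (≡-dec)
open import Function.Bundles using (_↔_; Inverse)
open import Relation.Binary.PropositionalEquality using (_≡_; refl; sym; trans; cong; cong₂; subst)
open import Relation.Nullary using (Dec; yes; no; ¬_; does)
open import Relation.Nullary.Decidable using (_×-dec_; _⊎-dec_)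

------------------------------------------------------------------------
-- Real numbers: Cauchy sequences of rationals, with setoid equality _≈_.

record ℝ : Set where
  constructor mkℝ
  field
    seq    : ℕ → ℚ
    cauchy : ∀ ε .{{_ : Positive ε}} →
             ∃[ N ] ∀ m n → N ≤ m → N ≤ n → ℚ.∣ seq m ℚ.- seq n ∣ ℚ.≤ ε

open ℝ public

infixl 6 _+ℝ_ _-ℝ_
infixl 7 _*ℝ_
infix  8 -ℝ_
infixr 8 _^ℝ_
infix  4 _≤ℝ_ _≈_

fromℚ : ℚ → ℝ
fromℚ q = mkℝ (λ _ → q) λ ε → 0 , λ _ _ _ _ →
  subst (ℚ._≤ ε) (sym (cong ℚ.∣_∣ (ℚₚ.+-inverseʳ q)))
    (ℚₚ.<⇒≤ (ℚₚ.positive⁻¹ ε))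

0ℝ 1ℝ : ℝ
0ℝ = fromℚ 0ℚ
1ℝ = fromℚ 1ℚ

private
  half-pos : ∀ ε .{{_ : Positive ε}} → Positive (½ ℚ.* ε)
  half-pos ε = ℚₚ.pos*pos⇒pos ½ ε

  halves : ∀ ε → ½ ℚ.* ε ℚ.+ ½ ℚ.* ε ≡ ε
  halves ε = trans (sym (ℚₚ.*-distribʳ-+ ε ½ ½)) (ℚₚ.*-identityˡ ε)

  +-diff : ∀ a b c d → (a ℚ.+ b) ℚ.- (c ℚ.+ d) ≡ (a ℚ.- c) ℚ.+ (b ℚ.- d)
  +-diff = solve 4 (λ a b c d → (a :+ b) :- (c :+ d) := (a :- c) :+ (b :- d)) refl
    where open +-*-Solver

  neg-diff : ∀ a b → ℚ.- a ℚ.- ℚ.- b ≡ ℚ.- (a ℚ.- b)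
  neg-diff = solve 2 (λ a b → :- a :- :- b := :- (a :- b)) refl
    where open +-*-Solver

  *-diff : ∀ a b c d → a ℚ.* b ℚ.- c ℚ.* d ≡ a ℚ.* (b ℚ.- d) ℚ.+ d ℚ.* (a ℚ.- c)
  *-diff = solve 4 (λ a b c d → a :* b :- c :* d := a :* (b :- d) :+ d :* (a :- c)) refl
    where open +-*-Solver

  split : ∀ a b → a ≡ b ℚ.+ (a ℚ.- b)
  split = solve 2 (λ a b → a := b :+ (a :- b)) refl
    where open +-*-Solver

  bounded : ∀ (x : ℝ) → ∃[ B ] Positive B × ∃[ N ] (∀ n → N ≤ n → ℚ.∣ seq x n ∣ ℚ.≤ B)
  bounded x with cauchy x 1ℚ
  ... | N , c = ℚ.∣ seq x N ∣ ℚ.+ 1ℚ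
              , ℚₚ.nonNeg+pos⇒pos ℚ.∣ seq x N ∣ {{ℚₚ.∣-∣-nonNeg (seq x N)}} 1ℚ
              , N
              , λ n N≤n → begin
                  ℚ.∣ seq x n ∣
                    ≡⟨ cong ℚ.∣_∣ (split (seq x n) (seq x N)) ⟩
                  ℚ.∣ seq x N ℚ.+ (seq x n ℚ.- seq x N) ∣
                    ≤⟨ ℚₚ.∣p+q∣≤∣p∣+∣q∣ (seq x N) (seq x n ℚ.- seq x N) ⟩
                  ℚ.∣ seq x N ∣ ℚ.+ ℚ.∣ seq x n ℚ.- seq x N ∣
                    ≤⟨ ℚₚ.+-monoʳ-≤ ℚ.∣ seq x N ∣ (c n N N≤n ≤-refl) ⟩
                  ℚ.∣ seq x N ∣ ℚ.+ 1ℚ ∎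
    where open ℚₚ.≤-Reasoning

  scaled : ∀ B ε → Positive B → .{{_ : Positive ε}} → ∃[ δ ] Positive δ × B ℚ.* δ ≡ ε
  scaled B ε B>0 = 1/B ℚ.* ε
                 , ℚₚ.pos*pos⇒pos 1/B {{ℚₚ.1/pos⇒pos B {{B>0}}}} ε
                 , trans (sym (ℚₚ.*-assoc B 1/B ε))
                     (trans (cong (ℚ._* ε) (ℚₚ.*-inverseʳ B {{B≠0}})) (ℚₚ.*-identityˡ ε))
    where
      B≠0 = ℚₚ.pos⇒nonZero B {{B>0}}
      1/B = (ℚ.1/ B) {{B≠0}}

  product-≤ : ∀ B δ a b → Positive B → ℚ.∣ a ∣ ℚ.≤ B → ℚ.∣ b ∣ ℚ.≤ δ → ℚ.∣ a ℚ.* b ∣ ℚ.≤ B ℚ.* δ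
  product-≤ B δ a b B>0 a≤ b≤ = begin
    ℚ.∣ a ℚ.* b ∣           ≡⟨ ℚₚ.∣p*q∣≡∣p∣*∣q∣ a b ⟩
    ℚ.∣ a ∣ ℚ.* ℚ.∣ b ∣     ≤⟨ ℚₚ.*-monoʳ-≤-nonNeg ℚ.∣ b ∣ {{ℚₚ.∣-∣-nonNeg b}} a≤ ⟩
    B ℚ.* ℚ.∣ b ∣           ≤⟨ ℚₚ.*-monoˡ-≤-nonNeg B {{ℚₚ.pos⇒nonNeg B {{B>0}}}} b≤ ⟩
    B ℚ.* δ                 ∎
    where open ℚₚ.≤-Reasoning

  ⊔-l : ∀ a b {n} → a ⊔ b ≤ n → a ≤ n
  ⊔-l a b = ≤-trans (m≤m⊔n a b)

  ⊔-r : ∀ a b {n} → a ⊔ b ≤ n → b ≤ n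
  ⊔-r a b = ≤-trans (m≤n⊔m a b)

_+ℝ_ : ℝ → ℝ → ℝ
x +ℝ y = mkℝ (λ n → seq x n ℚ.+ seq y n) cau
  where
  open ℚₚ.≤-Reasoning
  cau : ∀ ε .{{_ : Positive ε}} → ∃[ N ] ∀ m n → N ≤ m → N ≤ n →
        ℚ.∣ (seq x m ℚ.+ seq y m) ℚ.- (seq x n ℚ.+ seq y n) ∣ ℚ.≤ ε
  cau ε with cauchy x (½ ℚ.* ε) {{half-pos ε}} | cauchy y (½ ℚ.* ε) {{half-pos ε}}
  ... | N , c | K , d = N ⊔ K , λ m n p q → begin
    ℚ.∣ (seq x m ℚ.+ seq y m) ℚ.- (seq x n ℚ.+ seq y n) ∣
      ≡⟨ cong ℚ.∣_∣ (+-diff (seq x m) (seq y m) (seq x n) (seq y n)) ⟩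
    ℚ.∣ (seq x m ℚ.- seq x n) ℚ.+ (seq y m ℚ.- seq y n) ∣
      ≤⟨ ℚₚ.∣p+q∣≤∣p∣+∣q∣ (seq x m ℚ.- seq x n) (seq y m ℚ.- seq y n) ⟩
    ℚ.∣ seq x m ℚ.- seq x n ∣ ℚ.+ ℚ.∣ seq y m ℚ.- seq y n ∣
      ≤⟨ ℚₚ.+-mono-≤ (c m n (⊔-l N K p) (⊔-l N K q)) (d m n (⊔-r N K p) (⊔-r N K q)) ⟩
    ½ ℚ.* ε ℚ.+ ½ ℚ.* ε
      ≡⟨ halves ε ⟩
    ε ∎

-ℝ_ : ℝ → ℝ
-ℝ x = mkℝ (λ n → ℚ.- seq x n) cau
  where
  cau : ∀ ε .{{_ : Positive ε}} → ∃[ N ] ∀ m n → N ≤ m → N ≤ n →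
        ℚ.∣ ℚ.- seq x m ℚ.- ℚ.- seq x n ∣ ℚ.≤ ε
  cau ε with cauchy x ε
  ... | N , c = N , λ m n p q →
    subst (ℚ._≤ ε)
      (sym (trans (cong ℚ.∣_∣ (neg-diff (seq x m) (seq x n)))
                  (ℚₚ.∣-p∣≡∣p∣ (seq x m ℚ.- seq x n))))
      (c m n p q)

_-ℝ_ : ℝ → ℝ → ℝ
x -ℝ y = x +ℝ (-ℝ y)

private
  product-diff-≤ : ∀ B C δ η ε a b c d → Positive B → Positive C →
    B ℚ.* δ ≡ ½ ℚ.* ε → C ℚ.* η ≡ ½ ℚ.* ε →
    ℚ.∣ a ∣ ℚ.≤ B → ℚ.∣ d ∣ ℚ.≤ C → ℚ.∣ b ℚ.- d ∣ ℚ.≤ δ → ℚ.∣ a ℚ.- c ∣ ℚ.≤ η →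
    ℚ.∣ a ℚ.* b ℚ.- c ℚ.* d ∣ ℚ.≤ ε
  product-diff-≤ B C δ η ε a b c d B>0 C>0 Bδ Cη a≤ d≤ bd≤ ac≤ = begin
    ℚ.∣ a ℚ.* b ℚ.- c ℚ.* d ∣
      ≡⟨ cong ℚ.∣_∣ (*-diff a b c d) ⟩
    ℚ.∣ a ℚ.* (b ℚ.- d) ℚ.+ d ℚ.* (a ℚ.- c) ∣
      ≤⟨ ℚₚ.∣p+q∣≤∣p∣+∣q∣ (a ℚ.* (b ℚ.- d)) (d ℚ.* (a ℚ.- c)) ⟩
    ℚ.∣ a ℚ.* (b ℚ.- d) ∣ ℚ.+ ℚ.∣ d ℚ.* (a ℚ.- c) ∣
      ≤⟨ ℚₚ.+-mono-≤ (product-≤ B δ a (b ℚ.- d) B>0 a≤ bd≤)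
                     (product-≤ C η d (a ℚ.- c) C>0 d≤ ac≤) ⟩
    B ℚ.* δ ℚ.+ C ℚ.* η
      ≡⟨ cong₂ ℚ._+_ Bδ Cη ⟩
    ½ ℚ.* ε ℚ.+ ½ ℚ.* ε
      ≡⟨ halves ε ⟩
    ε ∎
    where open ℚₚ.≤-Reasoning

_*ℝ_ : ℝ → ℝ → ℝ
x *ℝ y = mkℝ (λ n → seq x n ℚ.* seq y n) cau
  where
  cau : ∀ ε .{{_ : Positive ε}} → ∃[ N ] ∀ m n → N ≤ m → N ≤ n →
        ℚ.∣ seq x m ℚ.* seq y m ℚ.- seq x n ℚ.* seq y n ∣ ℚ.≤ ε
  cau ε =
    let Bx , Bx>0 , Nx , bx = bounded x
        By , By>0 , Ny , by = bounded y
        δ , δ>0 , Bδ = scaled Bx (½ ℚ.* ε) Bx>0 {{half-pos ε}}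
        η , η>0 , Bη = scaled By (½ ℚ.* ε) By>0 {{half-pos ε}}
        K , c = cauchy y δ {{δ>0}}
        J , d = cauchy x η {{η>0}}
        P = Nx ⊔ Ny
        Q = K ⊔ J
    in P ⊔ Q , λ m n p q →
      product-diff-≤ Bx By δ η ε (seq x m) (seq y m) (seq x n) (seq y n) Bx>0 By>0 Bδ Bη
        (bx m (⊔-l Nx Ny (⊔-l P Q p)))
        (by n (⊔-r Nx Ny (⊔-l P Q q)))
        (c m n (⊔-l K J (⊔-r P Q p)) (⊔-l K J (⊔-r P Q q)))
        (d m n (⊔-r K J (⊔-r P Q p)) (⊔-r K J (⊔-r P Q q)))

_^ℝ_ : ℝ → ℕ → ℝ
x ^ℝ zero  = 1ℝ
x ^ℝ suc k = x *ℝ (x ^ℝ k)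

_≤ℝ_ : ℝ → ℝ → Set
x ≤ℝ y = ∀ ε .{{_ : Positive ε}} → ∃[ N ] ∀ n → N ≤ n → seq x n ℚ.≤ seq y n ℚ.+ ε

_≈_ : ℝ → ℝ → Set
x ≈ y = (x ≤ℝ y) × (y ≤ℝ x)

-- |x - y| ≤ ε, written without the absolute value.
Within : ℝ → ℝ → ℝ → Set
Within ε x y = (x -ℝ y ≤ℝ ε) × (-ℝ ε ≤ℝ x -ℝ y)

------------------------------------------------------------------------
-- Real polynomials in N variables: finite formal sums of terms c·z^e.
-- A monomial may occur in several terms.

Monomial : ℕ → Set
Monomial N = Vec ℕ N

Poly : ℕ → Set
Poly N = List (ℝ × Monomial N)

evalMonomial : ∀ {N} → Monomial N → Vec ℝ N → ℝ
evalMonomial []      []      = 1ℝ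
evalMonomial (k ∷ e) (z ∷ v) = (z ^ℝ k) *ℝ evalMonomial e v

eval : ∀ {N} → Poly N → Vec ℝ N → ℝ
eval []            v = 0ℝ
eval ((c , e) ∷ p) v = (c *ℝ evalMonomial e v) +ℝ eval p v

coeff : ∀ {N} → Poly N → Monomial N → ℝ
coeff []             e = 0ℝ
coeff ((c , e′) ∷ p) e = if does (≡-dec _≟_ e′ e) then c +ℝ coeff p e else coeff p e

Degree≤ : ∀ {N} → Poly N → ℕ → Set
Degree≤ p d = ∀ e → d < Vec.sum e → coeff p e ≈ 0ℝ

------------------------------------------------------------------------
-- Approximate degree of a total Boolean function.

bitℝ : Bool → ℝ
bitℝ b = if b then 1ℝ else 0ℝ

Approximates : ∀ {N} → Poly N → (Vec Bool N → Bool) → Set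
Approximates p g = ∀ z → Within (fromℚ (+ 1 ℚ./ 3)) (eval p (Vec.map bitℝ z)) (bitℝ (g z))

IsApproxDegree : ∀ {N} → (Vec Bool N → Bool) → ℕ → Set
IsApproxDegree g d =
  (∃[ p ] Degree≤ p d × Approximates p g) ×
  (∀ p d′ → Degree≤ p d′ → Approximates p g → d ≤ d′)

-- Picking the least element of an undecided set of naturals is classical,
-- hence the double negation.
approxDegree-exists : ∀ {N} {g : Vec Bool N → Bool} d p →
  Degree≤ p d → Approximates p g → ¬ ¬ (∃[ d′ ] IsApproxDegree g d′)
approxDegree-exists {N} {g} = <-rec _ step
  where
  step : ∀ d → (∀ {d′} → d′ < d → ∀ p → Degree≤ p d′ → Approximates p g →
           ¬ ¬ (∃[ d″ ] IsApproxDegree g d″)) →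
         ∀ p → Degree≤ p d → Approximates p g → ¬ ¬ (∃[ d″ ] IsApproxDegree g d″)
  step d ih p deg app none =
    none (d , (p , deg , app) , λ p′ d′ deg′ app′ →
      ≮⇒≥ (λ d′<d → ih d′<d p′ deg′ app′ none))

------------------------------------------------------------------------
-- Parameters.  Throughout n = 2^ℓ, so log₂ n is ℓ; the set [n] is Fin n.

size : ℕ → ℕ
size ℓ = 2 ^ ℓ

-- The largest m ≤ b with m^k ≤ a, i.e. min(b, ⌊a^(1/k)⌋) for k ≥ 1.
floorRoot : (k a b : ℕ) → ℕ
floorRoot k a zero    = zero
floorRoot k a (suc b) = if does (suc b ^ k ≤? a) then suc b else floorRoot k a b

-- ⌊n^((ℓ+1)/(ℓ+2))⌋; it is at most n, so searching up to n suffices.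
bigM : ℕ → ℕ
bigM ℓ = floorRoot (ℓ + 2) (size ℓ ^ (ℓ + 1)) (size ℓ)

bigL : ℕ → ℕ
bigL ℓ = ℓ * size ℓ

pairsInside : ∀ {ℓ n} → (Fin ℓ → Fin n → Fin n → Fin n) → Subset n → ℕ
pairsInside {ℓ} {n} r S = length (filter inside? (cartesianProduct (allFin n) (allFin n)))
  where
  inside? : (ij : Fin n × Fin n) →
    Dec (proj₁ ij ∈ S × proj₂ ij ∈ S × (∀ k → r k (proj₁ ij) (proj₂ ij) ∈ S))
  inside? (i , j) = (i ∈? S) ×-dec (j ∈? S) ×-dec all? (λ k → r k i j ∈? S)

-- The size condition |S| ≤ n^((ℓ+1)/(ℓ+2)) is written with both sides
-- raised to the power ℓ+2.
record Setup (ℓ : ℕ) : Set where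
  field
    name   : Vec Bool ℓ ↔ Fin (size ℓ)
    r      : Fin ℓ → Fin (size ℓ) → Fin (size ℓ) → Fin (size ℓ)
    sparse : ∀ (S : Subset (size ℓ)) → ∣ S ∣ ^ (ℓ + 2) ≤ size ℓ ^ (ℓ + 1) →
             pairsInside r S ≤ bigL ℓ

------------------------------------------------------------------------
-- Membership by binary search in a list that need not be sorted.

-- 1-based indexing.
_!_ : ∀ {A : Set} {m} → Vec A m → ℕ → Maybe A
[]       ! _           = nothing
(a ∷ as) ! 0           = nothing
(a ∷ as) ! 1           = just a
(a ∷ as) ! suc (suc k) = as ! suc k

-- While 1 ≤ lo < hi ≤ m+1 the probed index lies in 1..m, so the
-- out-of-range results below only matter for the final lookup, where
-- failure means lo = m+1.
below : ∀ {n} → Maybe (Fin n) → Fin n → Bool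
below (just a) i = does (a <ᶠ? i)
below nothing  i = false

equals : ∀ {n} → Maybe (Fin n) → Fin n → Bool
equals (just a) i = does (a ≟ᶠ i)
equals nothing  i = false

-- The final value of lo.  Each iteration shrinks hi - lo, so the loop
-- terminates by itself within hi - lo steps; the first argument bounds them.
search : ∀ {n m} → ℕ → Vec (Fin n) m → Fin n → (lo hi : ℕ) → ℕ
search zero       A i lo hi = lo
search (suc fuel) A i lo hi =
  if does (lo <? hi)
    then (if below (A ! mid) i
            then search fuel A i (suc mid) hi
            else search fuel A i lo mid)
    else lo
  where mid = ⌊ lo + hi /2⌋

mem : ∀ {n m} → Vec (Fin n) m → Fin n → Bool
mem {n} {m} A i = does (final ≤? m) ∧ equals (A ! final) i
  where final = search m A i 1 (m + 1)

------------------------------------------------------------------------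
-- Validity of descriptors.

Input : ℕ → Set
Input n = Fin n → Fin n → Fin 2 → Bool

b₁ b₂ : Fin 2
b₁ = zero
b₂ = suc zero

bit : Bool → ℕ
bit b = if b then 1 else 0

module _ {ℓ n m : ℕ} (r : Fin ℓ → Fin n → Fin n → Fin n) where

  E : Vec (Fin n) m → Fin n → Fin n → ℕ
  E A u v = bit (mem A u) * bit (mem A v) *
            product (map (λ k → bit (mem A (r k u v))) (allFin ℓ))

  -- All subtrahends here and in W are 0 or 1, so ∸ does not truncate.
  Z : Input n → Fin n → Fin n → ℕ
  Z x u v = (1 ∸ bit (x u v b₁)) * (1 ∸ bit (x v v b₂))

  W : Vec (Fin n) m → Input n → ℕ
  W A x = sum (map (λ u → sum (map (λ v →
            if does (u ≟ᶠ v) then 0 else E A u v * (1 ∸ Z x u v))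
            (allFin n))) (allFin n))

  Valid : Input n → Fin n → Vec (Fin n) m → Set
  Valid x j A =
    (∀ i → mem A i ≡ true ⊎ (x i j b₁ ≡ false × x i j b₂ ≡ false)) ×
    W A x ≡ 0

  valid? : ∀ x j A → Dec (Valid x j A)
  valid? x j A =
    all? (λ i → (mem A i ≟ᵇ true) ⊎-dec ((x i j b₁ ≟ᵇ false) ×-dec (x i j b₂ ≟ᵇ false)))
    ×-dec (W A x ≟ 0)

------------------------------------------------------------------------
-- The predicate as a Boolean function of the 2n² bits of x followed by
-- the (1+M)·log n descriptor bits: block 0 names j, block t ≥ 1 names a_t.

inputBits descBits totalBits : ℕ → ℕ
inputBits ℓ = 2 * (size ℓ * size ℓ)
descBits  ℓ = (1 + bigM ℓ) * ℓ
totalBits ℓ = inputBits ℓ + descBits ℓ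

decodeInput : ∀ ℓ → Vec Bool (totalBits ℓ) → Input (size ℓ)
decodeInput ℓ z i j b = lookup z (combine b (combine i j) ↑ˡ descBits ℓ)

module _ {ℓ : ℕ} (𝒮 : Setup ℓ) where
  open Setup 𝒮

  decodeBlock : Vec Bool (totalBits ℓ) → Fin (1 + bigM ℓ) → Fin (size ℓ)
  decodeBlock z t = Inverse.to name (tabulate λ s → lookup z (inputBits ℓ ↑ʳ combine t s))

  φ₀ : Vec Bool (totalBits ℓ) → Bool
  φ₀ z = does (valid? r (decodeInput ℓ z)
                        (decodeBlock z zero)
                        (tabulate λ t → decodeBlock z (suc t)))

------------------------------------------------------------------------

-- d ≤ c·√a, with both (nonnegative) sides squared.
SqrtBound : (d c a : ℕ) → Set
SqrtBound d c a = d ^ 2 ≤ c ^ 2 * a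

{-# OPTIONS --safe #-}

-- Let V(x, j, A) be the number of indices violating (K) plus W(A, x).  Then (j, A) is valid iff
-- V = 0.  Only entries of A pass the membership search, so there are at most M members and the
-- property of the maps r bounds W by L; hence 0 ≤ V ≤ m = n + L.  A membership search halves its
-- interval and is a decision tree of depth (ℓ + 2)ℓ on the bits of A, so each summand of V is a
-- decision tree of depth O(ℓ³) and V is a polynomial of that degree.  Put t(k) = 1 + (1 - k)·2/m
-- and choose s with m ≤ s² ≤ 4m.  The Chebyshev polynomial T_s is bounded by 1 at t(1), …, t(m),
-- because T² + (1 - t²)U² = 1, while T_s(t(0)) ≥ 1 + 2s²/m ≥ 3.  So T_s(t(V)) / T_s(t(0)) is 1 on
-- valid descriptors and at most 1/3 in absolute value on the others.

module Submission where

open import Algebra.Bundles using (module CommutativeRing)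
import Algebra.Properties.Semiring.Mult as SemiringMult
open import Data.Bool.Base using (Bool; true; false; if_then_else_; not; _∧_; _∨_)
open import Data.Fin.Base using (Fin; zero; suc; combine; _↑ˡ_; _↑ʳ_)
import Data.Fin.Properties as Finₚ
open import Data.Fin.Subset using (Subset; _∈_; ∣_∣; _∪_; ⊥; ⁅_⁆; inside; outside)
import Data.Fin.Subset.Properties as Subsetₚ
import Data.Integer.Base as ℤ
open import Data.List.Base
  using ([]; _∷_; _++_; map; length; allFin; filter; cartesianProduct)
import Data.List.Properties as Listₚ
open import Data.List.Relation.Unary.All as All using (All; []; _∷_)
import Data.List.Relation.Unary.All.Properties as Allₚ
open import Data.Maybe.Base using (Maybe; just; nothing)
open import Data.Nat.Base
  using (ℕ; zero; suc; _+_; _*_; _^_; _∸_; _≤_; _<_; ⌊_/2⌋; ⌈_/2⌉; z≤n; s≤s)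
open import Data.Nat.ListAction using (sum; product)
import Data.Nat.Properties as ℕₚ
open import Data.Nat.Solver using () renaming (module +-*-Solver to ℕ-Solver)
open import Data.Product.Base using (∃-syntax; _×_; _,_; proj₁; proj₂)
open import Data.Rational.Base as ℚ using (ℚ; 0ℚ; 1ℚ)
import Data.Rational.Properties as ℚₚ
open import Data.Rational.Solver using () renaming (module +-*-Solver to ℚ-Solver)
open import Data.Sum.Base using (_⊎_; inj₁; inj₂)
open import Data.Vec.Base as Vec using (Vec; []; _∷_; lookup; tabulate)
import Data.Vec.Properties as Vecₚ
open import Function.Bundles using (Inverse)
open import Relation.Binary.PropositionalEquality
  using (_≡_; _≢_; refl; sym; trans; cong; cong₂; subst)
open import Relation.Nullary using (Dec; yes; no; ¬_; does; contradiction)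
open import Relation.Nullary.Decidable using (decidable-stable)
open import Relation.Unary using (Decidable)
open import Defs

open SemiringMult (CommutativeRing.semiring ℚₚ.+-*-commutativeRing) using (×-homo-+)
  renaming (_×_ to _·_)

-- Iterated addition makes `ι (suc n)` unfold to `1ℚ ℚ.+ ι n`, so the order facts follow by plain
-- induction.
ι : ℕ → ℚ
ι n = n · 1ℚ

-- Decision trees

-- The tree is a derivation about the function it computes; the pointwise equations stand in for
-- function extensionality. A leaf fits every `d`, so `d` is an upper bound.
data Depth {N} {A : Set} : (Vec Bool N → A) → ℕ → Set where
  const : ∀ {f d} a → (∀ z → f z ≡ a) → Depth f d
  query : ∀ {f d} p {g : Bool → Vec Bool N → A} → (∀ b → Depth (g b) d) →
          (∀ z → f z ≡ g (lookup z p) z) → Depth f (suc d)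

module _ {N : ℕ} where

  weaken : ∀ {A : Set} {f : Vec Bool N → A} {d e} → d ≤ e → Depth f d → Depth f e
  weaken d≤e       (const a eq)   = const a eq
  weaken (s≤s d≤e) (query p t eq) = query p (λ b → weaken d≤e (t b)) eq

  respects : ∀ {A : Set} {f g : Vec Bool N → A} {d} → (∀ z → g z ≡ f z) → Depth f d → Depth g d
  respects g≗f (const a eq)   = const a (λ z → trans (g≗f z) (eq z))
  respects g≗f (query p t eq) = query p t (λ z → trans (g≗f z) (eq z))

  -- The tree of `g a` is grafted at each leaf `a` of the tree of `f`. Only the continuation
  -- selected by the answer is paid for, which is what keeps adaptive procedures cheap.
  bind : ∀ {A B : Set} {f : Vec Bool N → A} {d e} (g : A → Vec Bool N → B) →
         Depth f d → (∀ a → Depth (g a) e) → Depth (λ z → g (f z) z) (d + e)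
  bind {d = d} g (const a eq) t =
    weaken (ℕₚ.m≤n+m _ d) (respects (λ z → cong (λ a′ → g a′ z) (eq z)) (t a))
  bind g (query p t eq) u =
    query p (λ b → bind g (t b) u) (λ z → cong (λ a → g a z) (eq z))

  bind₂ : ∀ {A B C : Set} {f : Vec Bool N → A} {g : Vec Bool N → B} {d e} (_∙_ : A → B → C) →
          Depth f d → Depth g e → Depth (λ z → f z ∙ g z) (d + e)
  bind₂ {g = g} {e = e} _∙_ t u = bind (λ a z → a ∙ g z) t λ a →
    subst (Depth _) (ℕₚ.+-identityʳ e) (bind (λ b _ → a ∙ b) u λ b → const (a ∙ b) λ _ → refl)

  map-depth : ∀ {A B : Set} {f : Vec Bool N → A} {d} (g : A → B) →
              Depth f d → Depth (λ z → g (f z)) d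
  map-depth {d = d} g t = subst (Depth _) (ℕₚ.+-identityʳ d)
    (bind (λ a _ → g a) t λ a → const (g a) λ _ → refl)

  -- The condition does not depend on `z`, so deciding it costs no query.
  if-depth : ∀ {A P : Set} {f g : Vec Bool N → A} {d} (P? : Dec P) →
             (P → Depth f d) → (¬ P → Depth g d) → Depth (λ z → if does P? then f z else g z) d
  if-depth (yes p) t u = t p
  if-depth (no ¬p) t u = u ¬p

  lookup-depth : ∀ p → Depth {N} (λ z → lookup z p) 1
  lookup-depth p = query p {g = λ b _ → b} (λ b → const b λ _ → refl) λ _ → refl

  lookups-depth : ∀ {k} (p : Fin k → Fin N) → Depth {N} (λ z → tabulate λ s → lookup z (p s)) k
  lookups-depth {zero}  p = const [] λ _ → refl
  lookups-depth {suc k} p = bind₂ _∷_ (lookup-depth (p zero)) (lookups-depth λ s → p (suc s))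

  product-depth : ∀ {I : Set} {f : I → Vec Bool N → ℕ} {d} → (∀ i → Depth (f i) d) →
                  ∀ is → Depth (λ z → product (map (λ i → f i z) is)) (length is * d)
  product-depth t []       = const 1 λ _ → refl
  product-depth t (i ∷ is) = bind₂ _*_ (t i) (product-depth t is)

-- Polynomial representations

monomial-* : ∀ {N} → Monomial N → Monomial N → Monomial N
monomial-* = Vec.zipWith _+_

-- A bound on every listed term, hence stable under concatenation and products without comparing
-- coefficients.
Bounded : ∀ {N} → Poly N → ℕ → Set
Bounded p d = All (λ ce → Vec.sum (proj₂ ce) ≤ d) p

term-* : ∀ {N} → ℝ × Monomial N → Poly N → Poly N
term-* (c , e) = map λ { (c′ , e′) → c *ℝ c′ , monomial-* e e′ }

poly-* : ∀ {N} → Poly N → Poly N → Poly N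
poly-* []      q = []
poly-* (t ∷ p) q = term-* t q ++ poly-* p q

-- Identities between evaluations are proved index by index as equations in ℚ, which avoids
-- reasoning up to `_≈_`.
seq-^-+ : ∀ x j k n → seq (x ^ℝ (j + k)) n ≡ seq (x ^ℝ j) n ℚ.* seq (x ^ℝ k) n
seq-^-+ x zero    k n = sym (ℚₚ.*-identityˡ (seq (x ^ℝ k) n))
seq-^-+ x (suc j) k n = trans (cong (seq x n ℚ.*_) (seq-^-+ x j k n))
  (sym (ℚₚ.*-assoc (seq x n) (seq (x ^ℝ j) n) (seq (x ^ℝ k) n)))

seq-monomial-* : ∀ {N} (e e′ : Monomial N) v n →
  seq (evalMonomial (monomial-* e e′) v) n ≡ seq (evalMonomial e v) n ℚ.* seq (evalMonomial e′ v) n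
seq-monomial-* []      []       []      n = sym (ℚₚ.*-identityˡ 1ℚ)
seq-monomial-* (j ∷ e) (k ∷ e′) (x ∷ v) n = trans
  (cong₂ ℚ._*_ (seq-^-+ x j k n) (seq-monomial-* e e′ v n))
  (solve 4 (λ a b c d → (a :* b) :* (c :* d) := (a :* c) :* (b :* d)) refl
    (seq (x ^ℝ j) n) (seq (x ^ℝ k) n) (seq (evalMonomial e v) n) (seq (evalMonomial e′ v) n))
  where open ℚ-Solver

seq-++ : ∀ {N} (p q : Poly N) v n →
  seq (eval (p ++ q) v) n ≡ seq (eval p v) n ℚ.+ seq (eval q v) n
seq-++ []            q v n = sym (ℚₚ.+-identityˡ (seq (eval q v) n))
seq-++ ((c , e) ∷ p) q v n = trans
  (cong (seq (c *ℝ evalMonomial e v) n ℚ.+_) (seq-++ p q v n))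
  (sym (ℚₚ.+-assoc (seq (c *ℝ evalMonomial e v) n) (seq (eval p v) n) (seq (eval q v) n)))

seq-term-* : ∀ {N} c (e : Monomial N) q v n →
  seq (eval (term-* (c , e) q) v) n ≡ seq (c *ℝ evalMonomial e v) n ℚ.* seq (eval q v) n
seq-term-* c e []              v n = sym (ℚₚ.*-zeroʳ (seq (c *ℝ evalMonomial e v) n))
seq-term-* c e ((c′ , e′) ∷ q) v n = trans
  (cong₂ ℚ._+_ (cong ((seq c n ℚ.* seq c′ n) ℚ.*_) (seq-monomial-* e e′ v n)) (seq-term-* c e q v n))
  (solve 5 (λ a b x y r → (a :* b) :* (x :* y) :+ (a :* x) :* r := (a :* x) :* (b :* y :+ r)) refl
    (seq c n) (seq c′ n) (seq (evalMonomial e v) n) (seq (evalMonomial e′ v) n) (seq (eval q v) n))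
  where open ℚ-Solver

seq-poly-* : ∀ {N} (p q : Poly N) v n →
  seq (eval (poly-* p q) v) n ≡ seq (eval p v) n ℚ.* seq (eval q v) n
seq-poly-* []            q v n = sym (ℚₚ.*-zeroˡ (seq (eval q v) n))
seq-poly-* ((c , e) ∷ p) q v n = trans (seq-++ (term-* (c , e) q) (poly-* p q) v n) (trans
  (cong₂ ℚ._+_ (seq-term-* c e q v n) (seq-poly-* p q v n))
  (sym (ℚₚ.*-distribʳ-+ (seq (eval q v) n) (seq (c *ℝ evalMonomial e v) n) (seq (eval p v) n))))

sum-monomial-* : ∀ {N} (e e′ : Monomial N) → Vec.sum (monomial-* e e′) ≡ Vec.sum e + Vec.sum e′
sum-monomial-* []      []       = refl
sum-monomial-* (j ∷ e) (k ∷ e′) = trans (cong ((j + k) +_) (sum-monomial-* e e′))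
  (solve 4 (λ a b c d → (a :+ b) :+ (c :+ d) := (a :+ c) :+ (b :+ d)) refl j k (Vec.sum e) (Vec.sum e′))
  where open ℕ-Solver

bounded-* : ∀ {N} {p q : Poly N} {d d′} → Bounded p d → Bounded q d′ → Bounded (poly-* p q) (d + d′)
bounded-* []                bq = []
bounded-* {p = (c , e) ∷ _} (be ∷ bp) bq = Allₚ.++⁺
  (Allₚ.map⁺ (All.map (λ {ce} be′ → subst (_≤ _) (sym (sum-monomial-* e (proj₂ ce))) (ℕₚ.+-mono-≤ be be′)) bq))
  (bounded-* bp bq)

≤ℝ-refl : ∀ x → x ≤ℝ x
≤ℝ-refl x ε = 0 , λ n _ → subst (ℚ._≤ seq x n ℚ.+ ε) (ℚₚ.+-identityʳ (seq x n))
  (ℚₚ.+-monoʳ-≤ (seq x n) (ℚₚ.<⇒≤ (ℚₚ.positive⁻¹ ε)))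

if-no : ∀ {A P : Set} (P? : Dec P) {x y : A} → ¬ P → (if does P? then x else y) ≡ y
if-no (yes p) ¬p = contradiction p ¬p
if-no (no _)  ¬p = refl

-- A monomial of exponent sum above `d` matches no listed term, so the sum of its coefficients is
-- empty.
coeff-bounded : ∀ {N} (p : Poly N) {d} → Bounded p d → ∀ e → d < Vec.sum e → coeff p e ≡ 0ℝ
coeff-bounded []             []       e d<e = refl
coeff-bounded ((c , e′) ∷ p) (be ∷ b) e d<e = trans
  (if-no (Vecₚ.≡-dec ℕₚ._≟_ e′ e) λ { refl → ℕₚ.<⇒≱ d<e be })
  (coeff-bounded p b e d<e)

bounded⇒degree≤ : ∀ {N} (p : Poly N) {d} → Bounded p d → Degree≤ p d
bounded⇒degree≤ p b e d<e =
  subst (_≈ 0ℝ) (sym (coeff-bounded p b e d<e)) (≤ℝ-refl 0ℝ , ≤ℝ-refl 0ℝ)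

-- Agreement is asked at Boolean points only, and at every index: there the Cauchy sequence is
-- constant, so all later estimates take place in ℚ.
record HasDegree {N} (f : Vec Bool N → ℚ) (d : ℕ) : Set where
  field
    poly    : Poly N
    bounded : Bounded poly d
    agrees  : ∀ z n → seq (eval poly (Vec.map bitℝ z)) n ≡ f z

open HasDegree

module _ {N : ℕ} where

  sum-zeros : ∀ n → Vec.sum (Vec.replicate n 0) ≡ 0
  sum-zeros zero    = refl
  sum-zeros (suc n) = sum-zeros n

  seq-zeros : ∀ {m} (v : Vec ℝ m) n → seq (evalMonomial (Vec.replicate m 0) v) n ≡ 1ℚ
  seq-zeros []              n = refl
  seq-zeros {suc m} (x ∷ v) n =
    trans (ℚₚ.*-identityˡ (seq (evalMonomial (Vec.replicate m 0) v) n)) (seq-zeros v n)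

  const-degree : ∀ q → HasDegree {N} (λ _ → q) 0
  const-degree q .poly       = (fromℚ q , Vec.replicate N 0) ∷ []
  const-degree q .bounded    = ℕₚ.≤-reflexive (sum-zeros N) ∷ []
  const-degree q .agrees z n = trans (ℚₚ.+-identityʳ _)
    (trans (cong (q ℚ.*_) (seq-zeros (Vec.map bitℝ z) n)) (ℚₚ.*-identityʳ q))

  degree-mono : ∀ {f : Vec Bool N → ℚ} {d e} → d ≤ e → HasDegree f d → HasDegree f e
  degree-mono d≤e h .poly    = poly h
  degree-mono d≤e h .bounded = All.map (λ b → ℕₚ.≤-trans b d≤e) (bounded h)
  degree-mono d≤e h .agrees  = agrees h

  degree-cong : ∀ {f g : Vec Bool N → ℚ} {d} → (∀ z → f z ≡ g z) → HasDegree f d → HasDegree g d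
  degree-cong f≗g h .poly       = poly h
  degree-cong f≗g h .bounded    = bounded h
  degree-cong f≗g h .agrees z n = trans (agrees h z n) (f≗g z)

  +-degree : ∀ {f g : Vec Bool N → ℚ} {d} → HasDegree f d → HasDegree g d →
             HasDegree (λ z → f z ℚ.+ g z) d
  +-degree h k .poly       = poly h ++ poly k
  +-degree h k .bounded    = Allₚ.++⁺ (bounded h) (bounded k)
  +-degree h k .agrees z n =
    trans (seq-++ (poly h) (poly k) _ n) (cong₂ ℚ._+_ (agrees h z n) (agrees k z n))

  *-degree : ∀ {f g : Vec Bool N → ℚ} {d e} → HasDegree f d → HasDegree g e →
             HasDegree (λ z → f z ℚ.* g z) (d + e)
  *-degree h k .poly       = poly-* (poly h) (poly k)
  *-degree h k .bounded    = bounded-* (bounded h) (bounded k)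
  *-degree h k .agrees z n =
    trans (seq-poly-* (poly h) (poly k) _ n) (cong₂ ℚ._*_ (agrees h z n) (agrees k z n))

  affine-degree : ∀ {f : Vec Bool N → ℚ} {d} a b → HasDegree f d →
                  HasDegree (λ z → a ℚ.+ b ℚ.* f z) d
  affine-degree a b h = +-degree (degree-mono z≤n (const-degree a)) (*-degree (const-degree b) h)

-- From Boolean variables and decision trees to polynomials.

bitℚ : Bool → ℚ
bitℚ b = if b then 1ℚ else 0ℚ

seq-bitℝ : ∀ b n → seq (bitℝ b) n ≡ bitℚ b
seq-bitℝ true  n = refl
seq-bitℝ false n = refl

unit : ∀ {N} → Fin N → Monomial N
unit zero    = 1 ∷ Vec.replicate _ 0
unit (suc p) = 0 ∷ unit p

var-degree : ∀ {N} (p : Fin N) → HasDegree (λ z → bitℚ (lookup z p)) 1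
var-degree p .poly    = (1ℝ , unit p) ∷ []
var-degree p .bounded = ℕₚ.≤-reflexive (sum-unit p) ∷ []
  where
  sum-unit : ∀ {N} (p : Fin N) → Vec.sum (unit p) ≡ 1
  sum-unit {suc N} zero    = cong suc (sum-zeros {N} N)
  sum-unit         (suc p) = sum-unit p
var-degree p .agrees z n =
  trans (ℚₚ.+-identityʳ _) (trans (ℚₚ.*-identityˡ _) (seq-unit p z))
  where
  seq-unit : ∀ {N} (p : Fin N) z → seq (evalMonomial (unit p) (Vec.map bitℝ z)) n ≡ bitℚ (lookup z p)
  seq-unit {suc N} zero (b ∷ z) = trans
    (cong₂ ℚ._*_ (ℚₚ.*-identityʳ (seq (bitℝ b) n)) (seq-zeros {N} (Vec.map bitℝ z) n))
    (trans (ℚₚ.*-identityʳ (seq (bitℝ b) n)) (seq-bitℝ b n))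
  seq-unit (suc p) (b ∷ z) = trans (ℚₚ.*-identityˡ _) (seq-unit p z)

-- A query of a bit y becomes the interpolation y·(branch at 1) + (1 - y)·(branch at 0), which
-- raises the degree by one.
depth⇒degree : ∀ {N} {A : Set} {f : Vec Bool N → A} {d} (g : A → ℚ) →
               Depth f d → HasDegree (λ z → g (f z)) d
depth⇒degree g (const a eq) =
  degree-mono z≤n (degree-cong (λ z → cong g (sym (eq z))) (const-degree (g a)))
depth⇒degree g (query {f} p {h} t eq) = degree-cong choose
  (+-degree (*-degree (var-degree p) (depth⇒degree g (t true)))
            (*-degree (affine-degree 1ℚ (ℚ.- 1ℚ) (var-degree p)) (depth⇒degree g (t false))))
  where
  open ℚ-Solver

  select : ∀ b (k : Bool → ℚ) →
    bitℚ b ℚ.* k true ℚ.+ (1ℚ ℚ.+ ℚ.- 1ℚ ℚ.* bitℚ b) ℚ.* k false ≡ k b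
  select true  k = solve 2 (λ x y → con 1ℚ :* x :+ (con 1ℚ :+ con (ℚ.- 1ℚ) :* con 1ℚ) :* y := x) refl
    (k true) (k false)
  select false k = solve 2 (λ x y → con 0ℚ :* x :+ (con 1ℚ :+ con (ℚ.- 1ℚ) :* con 0ℚ) :* y := y) refl
    (k true) (k false)

  choose : ∀ z → bitℚ (lookup z p) ℚ.* g (h true z) ℚ.+
                 (1ℚ ℚ.+ ℚ.- 1ℚ ℚ.* bitℚ (lookup z p)) ℚ.* g (h false z) ≡ g (f z)
  choose z = trans (select (lookup z p) (λ b → g (h b z))) (cong g (sym (eq z)))

-- Adding polynomials does not raise the degree, whereas a single tree for the whole sum would be
-- deep; hence only the summands are treated as trees.
sum-degree : ∀ {N} {I : Set} {f : I → Vec Bool N → ℕ} {d} → (∀ i → HasDegree (λ z → ι (f i z)) d) →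
             ∀ is → HasDegree (λ z → ι (sum (map (λ i → f i z) is))) d
sum-degree         h []       = degree-mono z≤n (const-degree 0ℚ)
sum-degree {f = f} h (i ∷ is) = degree-cong (λ z → sym (×-homo-+ 1ℚ (f i z) _))
  (+-degree (h i) (sum-degree h is))

-- Chebyshev polynomials

module Chebyshev where

  open ℚ-Solver using (solve; _:+_; _:*_; _:-_; :-_; _:=_; con)
  open ℚₚ.≤-Reasoning

  -- U d is the Chebyshev polynomial of the second kind of degree d - 1.
  T U : ℕ → ℚ → ℚ
  T zero    t = 1ℚ
  T (suc d) t = t ℚ.* T d t ℚ.+ (t ℚ.* t ℚ.- 1ℚ) ℚ.* U d t
  U zero    t = 0ℚ
  U (suc d) t = T d t ℚ.+ t ℚ.* U d t

  -- T² - (t² - 1)U² is the norm of T + U√(t² - 1). One step of the recursion multiplies by t + √(t²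
  -- - 1), whose norm is 1.
  pell : ∀ d t → T d t ℚ.* T d t ℚ.+ (1ℚ ℚ.- t ℚ.* t) ℚ.* (U d t ℚ.* U d t) ≡ 1ℚ
  pell zero    t = solve 1 (λ t → con 1ℚ :* con 1ℚ :+ (con 1ℚ :- t :* t) :* (con 0ℚ :* con 0ℚ) := con 1ℚ) refl t
  pell (suc d) t = trans
    (solve 3 (λ t a b →
        (t :* a :+ (t :* t :- con 1ℚ) :* b) :* (t :* a :+ (t :* t :- con 1ℚ) :* b)
          :+ (con 1ℚ :- t :* t) :* ((a :+ t :* b) :* (a :+ t :* b))
        := a :* a :+ (con 1ℚ :- t :* t) :* (b :* b)) refl t (T d t) (U d t))
    (pell d t)

  0≤* : ∀ {p q} → 0ℚ ℚ.≤ p → 0ℚ ℚ.≤ q → 0ℚ ℚ.≤ p ℚ.* q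
  0≤* {p} {q} 0≤p 0≤q = ℚₚ.nonNegative⁻¹ (p ℚ.* q)
    {{ℚₚ.nonNeg*nonNeg⇒nonNeg p {{ℚ.nonNegative 0≤p}} q {{ℚ.nonNegative 0≤q}}}}

  0≤² : ∀ p → 0ℚ ℚ.≤ p ℚ.* p
  0≤² p with ℚₚ.≤-total 0ℚ p
  ... | inj₁ 0≤p = 0≤* 0≤p 0≤p
  ... | inj₂ p≤0 = subst (0ℚ ℚ.≤_) (solve 1 (λ p → (:- p) :* (:- p) := p :* p) refl p)
    (0≤* (ℚₚ.neg-antimono-≤ p≤0) (ℚₚ.neg-antimono-≤ p≤0))

  -- Reduces an inequality to a visibly nonnegative remainder `r` and an identity for the ring
  -- solver.
  ≤-by-gap : ∀ {p q} r → 0ℚ ℚ.≤ r → p ℚ.+ r ≡ q → p ℚ.≤ q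
  ≤-by-gap {p} {q} r 0≤r eq = begin
    p          ≡⟨ ℚₚ.+-identityʳ p ⟨
    p ℚ.+ 0ℚ   ≤⟨ ℚₚ.+-monoʳ-≤ p 0≤r ⟩
    p ℚ.+ r    ≡⟨ eq ⟩
    q          ∎

  0≤gap : ∀ {p q} → p ℚ.≤ q → 0ℚ ℚ.≤ q ℚ.- p
  0≤gap {p} {q} p≤q = subst (ℚ._≤ q ℚ.- p) (ℚₚ.+-inverseʳ p) (ℚₚ.+-monoˡ-≤ (ℚ.- p) p≤q)

  0≤+ : ∀ {p q} → 0ℚ ℚ.≤ p → 0ℚ ℚ.≤ q → 0ℚ ℚ.≤ p ℚ.+ q
  0≤+ = ℚₚ.+-mono-≤

  0≤1 : 0ℚ ℚ.≤ 1ℚ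
  0≤1 = ℚₚ.nonNegative⁻¹ 1ℚ

  ²≤1⇒≤1 : ∀ p → p ℚ.* p ℚ.≤ 1ℚ → p ℚ.≤ 1ℚ
  ²≤1⇒≤1 p p²≤1 = ℚₚ.≮⇒≥ λ 1<p → ℚₚ.<-irrefl refl (begin-strict
    1ℚ          <⟨ 1<p ⟩
    p           ≡⟨ ℚₚ.*-identityʳ p ⟨
    p ℚ.* 1ℚ    <⟨ ℚₚ.*-monoʳ-<-pos p {{ℚ.positive (ℚₚ.<-trans (ℚₚ.positive⁻¹ 1ℚ) 1<p)}} 1<p ⟩
    p ℚ.* p     ≤⟨ p²≤1 ⟩
    1ℚ          ∎)

  -- By `pell` the gap 1 - T² equals (1 - t²)U².
  T²≤1 : ∀ d t → 0ℚ ℚ.≤ 1ℚ ℚ.- t ℚ.* t → T d t ℚ.* T d t ℚ.≤ 1ℚ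
  T²≤1 d t 0≤1-t² = ≤-by-gap _ (0≤* 0≤1-t² (0≤² (U d t))) (pell d t)

  T≤1 : ∀ d t → 0ℚ ℚ.≤ 1ℚ ℚ.- t ℚ.* t → T d t ℚ.≤ 1ℚ
  T≤1 d t h = ²≤1⇒≤1 (T d t) (T²≤1 d t h)

  -T≤1 : ∀ d t → 0ℚ ℚ.≤ 1ℚ ℚ.- t ℚ.* t → ℚ.- T d t ℚ.≤ 1ℚ
  -T≤1 d t h = ²≤1⇒≤1 (ℚ.- T d t)
    (subst (ℚ._≤ 1ℚ) (solve 1 (λ p → p :* p := (:- p) :* (:- p)) refl (T d t)) (T²≤1 d t h))

  0≤ι : ∀ n → 0ℚ ℚ.≤ ι n
  0≤ι zero    = ℚₚ.≤-refl
  0≤ι (suc n) = 0≤+ 0≤1 (0≤ι n)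

  ι-mono : ∀ {m n} → m ≤ n → ι m ℚ.≤ ι n
  ι-mono {n = n} z≤n = 0≤ι n
  ι-mono (s≤s m≤n)   = ℚₚ.+-monoʳ-≤ 1ℚ (ι-mono m≤n)

  -- The bound for `T` is its tangent line at 1, of slope d². The recursions of `T` and `U` are
  -- coupled, so both bounds go through one induction.
  T-growth : ∀ d μ → 0ℚ ℚ.≤ μ →
    1ℚ ℚ.+ ι (d * d) ℚ.* μ ℚ.≤ T d (1ℚ ℚ.+ μ) × ι d ℚ.≤ U d (1ℚ ℚ.+ μ)
  T-growth zero    μ 0≤μ = ℚₚ.≤-reflexive (trans (cong (1ℚ ℚ.+_) (ℚₚ.*-zeroˡ μ)) (ℚₚ.+-identityʳ 1ℚ)) , ℚₚ.≤-refl
  T-growth (suc d) μ 0≤μ with T-growth d μ 0≤μ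
  ... | ihT , ihU = stepT , stepU
    where
    a = T d (1ℚ ℚ.+ μ) ; b = U d (1ℚ ℚ.+ μ) ; δ = ι d ; σ = ι (d * d)

    0≤σμ = 0≤* (0≤ι (d * d)) 0≤μ
    0≤gapT = 0≤gap ihT
    0≤gapU = 0≤gap ihU
    0≤b : 0ℚ ℚ.≤ b
    0≤b = ℚₚ.≤-trans (0≤ι d) ihU

    square : ι (suc d * suc d) ≡ 1ℚ ℚ.+ (δ ℚ.+ δ) ℚ.+ σ
    square = trans (cong (1ℚ ℚ.+_) (trans (×-homo-+ 1ℚ d (d * suc d))
        (cong (δ ℚ.+_) (trans (cong ι (ℕₚ.*-suc d d)) (×-homo-+ 1ℚ d (d * d))))))
      (solve 2 (λ x y → con 1ℚ :+ (x :+ (x :+ y)) := con 1ℚ :+ (x :+ x) :+ y) refl δ σ)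

    -- The new value is (1 + μ)a + (2μ + μ²)b. Inserting a ≥ 1 + σμ and b ≥ δ leaves the two
    -- weighted slacks together with σμ² and μ²b.
    gap = (a ℚ.- (1ℚ ℚ.+ σ ℚ.* μ)) ℚ.* (1ℚ ℚ.+ μ) ℚ.+ (σ ℚ.* μ) ℚ.* μ
        ℚ.+ ((μ ℚ.+ μ) ℚ.* (b ℚ.- δ) ℚ.+ (μ ℚ.* μ) ℚ.* b)

    stepT : 1ℚ ℚ.+ ι (suc d * suc d) ℚ.* μ ℚ.≤ T (suc d) (1ℚ ℚ.+ μ)
    stepT = ≤-by-gap gap
      (0≤+ (0≤+ (0≤* 0≤gapT (0≤+ 0≤1 0≤μ)) (0≤* 0≤σμ 0≤μ))
        (0≤+ (0≤* (0≤+ 0≤μ 0≤μ) 0≤gapU) (0≤* (0≤² μ) 0≤b)))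
      (trans (cong (λ s → 1ℚ ℚ.+ s ℚ.* μ ℚ.+ gap) square)
        (solve 5 (λ a b δ σ μ →
          con 1ℚ :+ (con 1ℚ :+ (δ :+ δ) :+ σ) :* μ
            :+ ((a :- (con 1ℚ :+ σ :* μ)) :* (con 1ℚ :+ μ) :+ (σ :* μ) :* μ
              :+ ((μ :+ μ) :* (b :- δ) :+ (μ :* μ) :* b))
          := (con 1ℚ :+ μ) :* a :+ ((con 1ℚ :+ μ) :* (con 1ℚ :+ μ) :- con 1ℚ) :* b) refl a b δ σ μ))

    stepU : ι (suc d) ℚ.≤ U (suc d) (1ℚ ℚ.+ μ)
    stepU = ≤-by-gap
      ((a ℚ.- (1ℚ ℚ.+ σ ℚ.* μ)) ℚ.+ σ ℚ.* μ ℚ.+ ((b ℚ.- δ) ℚ.+ μ ℚ.* b))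
      (0≤+ (0≤+ 0≤gapT 0≤σμ) (0≤+ 0≤gapU (0≤* 0≤μ 0≤b)))
      (solve 5 (λ a b δ σ μ →
        con 1ℚ :+ δ :+ ((a :- (con 1ℚ :+ σ :* μ)) :+ σ :* μ :+ ((b :- δ) :+ μ :* b))
        := a :+ (con 1ℚ :+ μ) :* b) refl a b δ σ μ)

  module _ {N : ℕ} {f : Vec Bool N → ℚ} {D : ℕ} (h : HasDegree f D) where

    T-degree : ∀ d → HasDegree (λ z → T d (f z)) (d * D)
    -- For U d alone the degree would be (d - 1)D, which is negative at d = 0.
    [t²-1]U-degree : ∀ d → HasDegree (λ z → (f z ℚ.* f z ℚ.- 1ℚ) ℚ.* U d (f z)) (D + d * D)

    T-degree zero    = const-degree 1ℚ
    T-degree (suc d) = +-degree (*-degree h (T-degree d)) ([t²-1]U-degree d)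

    [t²-1]U-degree zero    = degree-cong (λ z → sym (ℚₚ.*-zeroʳ (f z ℚ.* f z ℚ.- 1ℚ)))
      (degree-mono z≤n (const-degree 0ℚ))
    [t²-1]U-degree (suc d) = degree-cong
      (λ z → solve 3 (λ t a b →
        (con (ℚ.- 1ℚ) :+ con 1ℚ :* (t :* t)) :* a :+ t :* ((t :* t :- con 1ℚ) :* b)
        := (t :* t :- con 1ℚ) :* (a :+ t :* b)) refl (f z) (T d (f z)) (U d (f z)))
      (+-degree
        (degree-mono (ℕₚ.≤-reflexive (ℕₚ.+-assoc D D (d * D)))
          (*-degree (affine-degree (ℚ.- 1ℚ) 1ℚ (*-degree h h)) (T-degree d)))
        (*-degree h ([t²-1]U-degree d)))

  ⅓ : ℚ
  ⅓ = ℤ.+ 1 ℚ./ 3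

  -- Only integer arguments are constrained, because the polynomial will be applied to a count of
  -- violations.
  record Separates (m : ℕ) (q : ℚ → ℚ) : Set where
    field
      at-0  : q 0ℚ ≡ 1ℚ
      upper : ∀ k → 1 ≤ k → k ≤ m → q (ι k) ℚ.≤ ⅓
      lower : ∀ k → 1 ≤ k → k ≤ m → ℚ.- ⅓ ℚ.≤ q (ι k)

  module Separator (m d : ℕ) (1≤m : 1 ≤ m) (m≤d² : m ≤ d * d) where

    private
      instance
        ιm>0 : ℚ.Positive (ι m)
        ιm>0 = ℚ.positive (ℚₚ.<-≤-trans (ℚₚ.positive⁻¹ 1ℚ) (ι-mono 1≤m))
        ιm≠0 : ℚ.NonZero (ι m)
        ιm≠0 = ℚₚ.pos⇒nonZero (ι m)

      2ℚ 3ℚ μ T₀ : ℚ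
      2ℚ = 1ℚ ℚ.+ 1ℚ
      3ℚ = 1ℚ ℚ.+ 2ℚ
      -- With step 2/m, `node` sends 0 to 1 + μ, 1 to 1 and m to -1 + μ, so the points 1, ..., m
      -- land in [-1, 1].
      μ  = ℚ.1/ ι m ℚ.* 2ℚ
      T₀ = T d (1ℚ ℚ.+ μ)

      0≤μ : 0ℚ ℚ.≤ μ
      0≤μ = 0≤* (ℚₚ.<⇒≤ (ℚₚ.positive⁻¹ (ℚ.1/ ι m) {{ℚₚ.1/pos⇒pos (ι m)}})) (0≤+ 0≤1 0≤1)

      mμ≡2 : ι m ℚ.* μ ≡ 2ℚ
      mμ≡2 = trans (sym (ℚₚ.*-assoc (ι m) (ℚ.1/ ι m) 2ℚ))
        (trans (cong (ℚ._* 2ℚ) (ℚₚ.*-inverseʳ (ι m))) (ℚₚ.*-identityˡ 2ℚ))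

      -- Growth gives 1 + d²μ, and d² ≥ m together with mμ = 2 makes this at least 3.
      3≤T₀ : 3ℚ ℚ.≤ T₀
      3≤T₀ = begin
        1ℚ ℚ.+ 2ℚ                ≡⟨ cong (1ℚ ℚ.+_) mμ≡2 ⟨
        1ℚ ℚ.+ ι m ℚ.* μ         ≤⟨ ℚₚ.+-monoʳ-≤ 1ℚ (ℚₚ.*-monoʳ-≤-nonNeg μ {{ℚ.nonNegative 0≤μ}} (ι-mono m≤d²)) ⟩
        1ℚ ℚ.+ ι (d * d) ℚ.* μ   ≤⟨ proj₁ (T-growth d μ 0≤μ) ⟩
        T₀                       ∎

      instance
        T₀>0 : ℚ.Positive T₀
        T₀>0 = ℚ.positive (ℚₚ.<-≤-trans (ℚₚ.positive⁻¹ 3ℚ) 3≤T₀)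
        T₀≠0 : ℚ.NonZero T₀
        T₀≠0 = ℚₚ.pos⇒nonZero T₀

      c : ℚ
      c = ℚ.1/ T₀

      0≤c : 0ℚ ℚ.≤ c
      0≤c = ℚₚ.<⇒≤ (ℚₚ.positive⁻¹ c {{ℚₚ.1/pos⇒pos T₀}})

      c≤⅓ : c ℚ.≤ ⅓
      c≤⅓ = begin
        c                     ≡⟨ solve 1 (λ c → c := con ⅓ :* (c :* con 3ℚ)) refl c ⟩
        ⅓ ℚ.* (c ℚ.* 3ℚ)      ≤⟨ ℚₚ.*-monoˡ-≤-nonNeg ⅓ (ℚₚ.*-monoˡ-≤-nonNeg c {{ℚ.nonNegative 0≤c}} 3≤T₀) ⟩
        ⅓ ℚ.* (c ℚ.* T₀)      ≡⟨ cong (⅓ ℚ.*_) (ℚₚ.*-inverseˡ T₀) ⟩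
        ⅓ ℚ.* 1ℚ              ≡⟨ ℚₚ.*-identityʳ ⅓ ⟩
        ⅓                     ∎

      node : ℚ → ℚ
      node x = (1ℚ ℚ.+ μ) ℚ.+ ℚ.- μ ℚ.* x

      c*≤⅓ : ∀ {p} → p ℚ.≤ 1ℚ → c ℚ.* p ℚ.≤ ⅓
      c*≤⅓ {p} p≤1 = begin
        c ℚ.* p   ≤⟨ ℚₚ.*-monoˡ-≤-nonNeg c {{ℚ.nonNegative 0≤c}} p≤1 ⟩
        c ℚ.* 1ℚ  ≡⟨ ℚₚ.*-identityʳ c ⟩
        c         ≤⟨ c≤⅓ ⟩
        ⅓         ∎

      -- With y = (k - 1)μ the node is 1 - y, and 1 - (1 - y)² = y(2 - y).
      node-in : ∀ k → 1 ≤ k → k ≤ m → 0ℚ ℚ.≤ 1ℚ ℚ.- node (ι k) ℚ.* node (ι k)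
      node-in k 1≤k k≤m = subst (0ℚ ℚ.≤_) factored (0≤* 0≤y (0≤gap y≤2))
        where
        y = (ι k ℚ.- 1ℚ) ℚ.* μ
        0≤y : 0ℚ ℚ.≤ y
        0≤y = 0≤* (0≤gap (ι-mono 1≤k)) 0≤μ
        y≤2 : y ℚ.≤ 2ℚ
        -- As mμ = 2, the gap 2 - y is (m - k + 1)μ.
        y≤2 = ≤-by-gap ((ι m ℚ.- ι k ℚ.+ 1ℚ) ℚ.* μ) (0≤* (0≤+ (0≤gap (ι-mono k≤m)) 0≤1) 0≤μ)
          (trans (solve 3 (λ k m μ → (k :- con 1ℚ) :* μ :+ (m :- k :+ con 1ℚ) :* μ := m :* μ) refl (ι k) (ι m) μ) mμ≡2)
        factored : y ℚ.* (2ℚ ℚ.- y) ≡ 1ℚ ℚ.- node (ι k) ℚ.* node (ι k)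
        factored = solve 2 (λ k μ → ((k :- con 1ℚ) :* μ) :* (con 2ℚ :- (k :- con 1ℚ) :* μ)
          := con 1ℚ :- ((con 1ℚ :+ μ) :+ (:- μ) :* k) :* ((con 1ℚ :+ μ) :+ (:- μ) :* k)) refl (ι k) μ

    separator : ℚ → ℚ
    separator x = c ℚ.* T d (node x)

    separates : Separates m separator
    separates .Separates.at-0 = trans
      (cong (λ t → c ℚ.* T d t) (solve 1 (λ μ → (con 1ℚ :+ μ) :+ (:- μ) :* con 0ℚ := con 1ℚ :+ μ) refl μ))
      (ℚₚ.*-inverseˡ T₀)
    separates .Separates.upper k 1≤k k≤m = c*≤⅓ (T≤1 d (node (ι k)) (node-in k 1≤k k≤m))
    separates .Separates.lower k 1≤k k≤m = begin
      ℚ.- ⅓                       ≤⟨ ℚₚ.neg-antimono-≤ (c*≤⅓ (-T≤1 d (node (ι k)) (node-in k 1≤k k≤m))) ⟩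
      ℚ.- (c ℚ.* ℚ.- Tk)          ≡⟨ solve 2 (λ c t → :- (c :* (:- t)) := c :* t) refl c Tk ⟩
      c ℚ.* Tk                    ∎
      where Tk = T d (node (ι k))

    separator-degree : ∀ {N D} {f : Vec Bool N → ℚ} → HasDegree f D →
                       HasDegree (λ z → separator (f z)) (d * D)
    separator-degree h = *-degree (const-degree c) (T-degree (affine-degree (1ℚ ℚ.+ μ) (ℚ.- μ) h) d)

open Chebyshev

-- Binary search

if-elim : ∀ {A P : Set} (Q : A → Set) (P? : Dec P) {x y} →
          (P → Q x) → (¬ P → Q y) → Q (if does P? then x else y)
if-elim Q (yes p) qx qy = qx p
if-elim Q (no ¬p) qx qy = qy ¬p

does⇒ : ∀ {P : Set} (P? : Dec P) → does P? ≡ true → P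
does⇒ (yes p) _ = p

⌊lo+hi/2⌋ : ∀ lo e → ⌊ lo + (lo + e) /2⌋ ≡ lo + ⌊ e /2⌋
⌊lo+hi/2⌋ zero     e = refl
⌊lo+hi/2⌋ (suc lo) e =
  trans (cong (λ k → ⌊ suc k /2⌋) (ℕₚ.+-suc lo (lo + e))) (cong suc (⌊lo+hi/2⌋ lo e))

⌊/2⌋<2^ : ∀ s e → e < 2 ^ suc s → ⌊ e /2⌋ < 2 ^ s
⌊/2⌋<2^ s e e<2^ = ℕₚ.≰⇒> λ 2^s≤ → ℕₚ.<-irrefl refl (begin-strict
  2 ^ s + (2 ^ s + 0)        ≡⟨ cong (2 ^ s +_) (ℕₚ.+-identityʳ (2 ^ s)) ⟩
  2 ^ s + 2 ^ s              ≤⟨ ℕₚ.+-mono-≤ 2^s≤ (ℕₚ.≤-trans 2^s≤ (ℕₚ.⌊n/2⌋≤⌈n/2⌉ e)) ⟩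
  ⌊ e /2⌋ + ⌈ e /2⌉          ≡⟨ ℕₚ.⌊n/2⌋+⌈n/2⌉≡n e ⟩
  e                          <⟨ e<2^ ⟩
  2 ^ s + (2 ^ s + 0)        ∎)
  where open ℕₚ.≤-Reasoning

-- The right part drops the midpoint, which offsets the rounding, so both parts have length at most
-- ⌊e/2⌋.
module Halving (lo hi : ℕ) (lo<hi : lo < hi) where

  private
    e = hi ∸ lo
    mid = ⌊ lo + hi /2⌋

    lo+e : lo + e ≡ hi
    lo+e = ℕₚ.m+[n∸m]≡n (ℕₚ.<⇒≤ lo<hi)

    mid≡ : mid ≡ lo + ⌊ e /2⌋
    mid≡ = trans (cong (λ h → ⌊ lo + h /2⌋) (sym lo+e)) (⌊lo+hi/2⌋ lo e)

  left : mid ∸ lo ≤ ⌊ e /2⌋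
  left = ℕₚ.≤-reflexive (trans (cong (_∸ lo) mid≡) (ℕₚ.m+n∸m≡n lo ⌊ e /2⌋))

  right : hi ∸ suc mid ≤ ⌊ e /2⌋
  right = ℕₚ.m≤n+o⇒m∸n≤o hi (suc mid) (begin
    hi                                 ≡⟨ lo+e ⟨
    lo + e                             ≡⟨ cong (lo +_) (ℕₚ.⌊n/2⌋+⌈n/2⌉≡n e) ⟨
    -- ⌈e/2⌉ unfolds to ⌊(e + 1)/2⌋, and ⌊(e + 2)/2⌋ reduces to 1 + ⌊e/2⌋.
    lo + (⌊ e /2⌋ + ⌈ e /2⌉)           ≤⟨ ℕₚ.+-monoʳ-≤ lo (ℕₚ.+-monoʳ-≤ ⌊ e /2⌋ (ℕₚ.⌊n/2⌋-mono (ℕₚ.n≤1+n (suc e)))) ⟩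
    lo + (⌊ e /2⌋ + suc ⌊ e /2⌋)       ≡⟨ ℕₚ.+-assoc lo ⌊ e /2⌋ (suc ⌊ e /2⌋) ⟨
    (lo + ⌊ e /2⌋) + suc ⌊ e /2⌋       ≡⟨ ℕₚ.+-suc (lo + ⌊ e /2⌋) ⌊ e /2⌋ ⟩
    suc (lo + ⌊ e /2⌋) + ⌊ e /2⌋       ≡⟨ cong (λ m → suc m + ⌊ e /2⌋) mid≡ ⟨
    suc mid + ⌊ e /2⌋                  ∎)
    where open ℕₚ.≤-Reasoning

module SearchDepth {N n m w : ℕ} {A : Vec Bool N → Vec (Fin n) m}
                   (entry : ∀ k → Depth (λ z → A z ! k) w) where

  -- Recursion is on `fuel`, but the cost is measured by `s`: each probe reads one entry and halves
  -- the interval. Counting by `fuel` would give a depth linear in m.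
  search-depth : ∀ fuel s i lo hi → hi ∸ lo < 2 ^ s →
                 Depth (λ z → search fuel (A z) i lo hi) (s * w)
  search-depth zero       s i lo hi _    = const lo λ _ → refl
  search-depth (suc fuel) s i lo hi gap< =
    if-depth (lo ℕₚ.<? hi) (λ lo<hi → step s lo<hi gap<) (λ _ → const lo λ _ → refl)
    where
    mid = ⌊ lo + hi /2⌋

    next : Maybe (Fin n) → Vec Bool N → ℕ
    next a z = if below a i then search fuel (A z) i (suc mid) hi else search fuel (A z) i lo mid

    step : ∀ s → lo < hi → hi ∸ lo < 2 ^ s → Depth (λ z → next (A z ! mid) z) (s * w)
    step zero    lo<hi gap< = contradiction (ℕₚ.m<n⇒0<n∸m lo<hi) (ℕₚ.<⇒≱ gap<)
    step (suc s) lo<hi gap< = bind next (entry mid) λ a → select (below a i)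
      where
      open Halving lo hi lo<hi
      half< = ⌊/2⌋<2^ s (hi ∸ lo) gap<
      select : ∀ b → Depth (λ z → if b then search fuel (A z) i (suc mid) hi
                                       else search fuel (A z) i lo mid) (s * w)
      select true  = search-depth fuel s i (suc mid) hi (ℕₚ.≤-<-trans right half<)
      select false = search-depth fuel s i lo mid (ℕₚ.≤-<-trans left half<)

  -- The initial interval has length m, so s probes suffice; the last `w` pays for the final
  -- comparison.
  mem-depth : ∀ s i → m < 2 ^ s → Depth (λ z → mem (A z) i) (s * w + w)
  mem-depth s i m<2^s = bind (λ k z → does (k ℕₚ.≤? m) ∧ equals (A z ! k) i)
    (search-depth m s i 1 (m + 1) (subst (_< 2 ^ s) (sym (ℕₚ.m+n∸n≡m m 1)) m<2^s))
    (λ k → map-depth (λ a → does (k ℕₚ.≤? m) ∧ equals a i) (entry k))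

-- An index outside 1, ..., m yields `nothing` without a query; any other index costs one entry.
tabulate-entry-depth : ∀ {N m d} {A : Set} {f : Fin m → Vec Bool N → A} →
  (∀ t → Depth (f t) d) → ∀ k → Depth (λ z → tabulate (λ t → f t z) ! k) d
tabulate-entry-depth {m = zero}  t k             = const nothing λ _ → refl
tabulate-entry-depth {m = suc m} t zero          = const nothing λ _ → refl
tabulate-entry-depth {m = suc m} t (suc zero)    = map-depth just (t zero)
tabulate-entry-depth {m = suc m} t (suc (suc k)) = tabulate-entry-depth (λ s → t (suc s)) (suc k)

-- The set of list members

members : ∀ {n m} → Vec (Fin n) m → Subset n
members A = tabulate (mem A)

-- All values that occur; in an unsorted list the search may miss some of them.
entries : ∀ {n m} → Vec (Fin n) m → Subset n
entries []       = ⊥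
entries (a ∷ as) = ⁅ a ⁆ ∪ entries as

∣p∪q∣≤∣p∣+∣q∣ : ∀ {n} (p q : Subset n) → ∣ p ∪ q ∣ ≤ ∣ p ∣ + ∣ q ∣
∣p∪q∣≤∣p∣+∣q∣ []            []            = z≤n
∣p∪q∣≤∣p∣+∣q∣ (outside ∷ p) (outside ∷ q) = ∣p∪q∣≤∣p∣+∣q∣ p q
∣p∪q∣≤∣p∣+∣q∣ (outside ∷ p) (inside  ∷ q) =
  ℕₚ.≤-trans (s≤s (∣p∪q∣≤∣p∣+∣q∣ p q)) (ℕₚ.≤-reflexive (sym (ℕₚ.+-suc ∣ p ∣ ∣ q ∣)))
∣p∪q∣≤∣p∣+∣q∣ (inside  ∷ p) (outside ∷ q) = s≤s (∣p∪q∣≤∣p∣+∣q∣ p q)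
∣p∪q∣≤∣p∣+∣q∣ (inside  ∷ p) (inside  ∷ q) =
  s≤s (ℕₚ.≤-trans (∣p∪q∣≤∣p∣+∣q∣ p q) (ℕₚ.+-monoʳ-≤ ∣ p ∣ (ℕₚ.n≤1+n ∣ q ∣)))

∣entries∣≤ : ∀ {n m} (A : Vec (Fin n) m) → ∣ entries A ∣ ≤ m
∣entries∣≤ {n} []   = ℕₚ.≤-reflexive (Subsetₚ.∣⊥∣≡0 n)
∣entries∣≤ (a ∷ as) = ℕₚ.≤-trans (∣p∪q∣≤∣p∣+∣q∣ ⁅ a ⁆ (entries as))
  (ℕₚ.+-mono-≤ (ℕₚ.≤-reflexive (Subsetₚ.∣⁅x⁆∣≡1 a)) (∣entries∣≤ as))

equals⇒∈entries : ∀ {n m} (A : Vec (Fin n) m) k i → equals (A ! k) i ≡ true → i ∈ entries A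
equals⇒∈entries (a ∷ as) (suc zero) i eq =
  Subsetₚ.x∈p∪q⁺ (inj₁ (subst (_∈ ⁅ a ⁆) (does⇒ (a Finₚ.≟ i) eq) (Subsetₚ.x∈⁅x⁆ a)))
equals⇒∈entries (a ∷ as) (suc (suc k)) i eq =
  Subsetₚ.x∈p∪q⁺ (inj₂ (equals⇒∈entries as (suc k) i eq))

∧-true₂ : ∀ a {b} → a ∧ b ≡ true → b ≡ true
∧-true₂ true eq = eq

-- A successful search ends at an entry equal to `i`, whatever the order of the list, so members are
-- entries.
∣members∣≤ : ∀ {n m} (A : Vec (Fin n) m) → ∣ members A ∣ ≤ m
∣members∣≤ {m = m} A = ℕₚ.≤-trans (Subsetₚ.p⊆q⇒∣p∣≤∣q∣ members⊆entries) (∣entries∣≤ A)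
  where
  members⊆entries : ∀ {i} → i ∈ members A → i ∈ entries A
  members⊆entries {i} i∈ = equals⇒∈entries A (search m A i 1 (m + 1)) i
    (∧-true₂ (does (search m A i 1 (m + 1) ℕₚ.≤? m))
      (trans (sym (Vecₚ.lookup∘tabulate (mem A) i)) (Vecₚ.[]=⇒lookup i∈)))

mem⇒∈members : ∀ {n m} (A : Vec (Fin n) m) i → mem A i ≡ true → i ∈ members A
mem⇒∈members A i eq = Vecₚ.lookup⇒[]= i (members A) (trans (Vecₚ.lookup∘tabulate (mem A) i) eq)

-- Finite sums

module _ {I : Set} {f : I → ℕ} where

  sum≡0⇒ : ∀ is → sum (map f is) ≡ 0 → All (λ i → f i ≡ 0) is
  sum≡0⇒ []       _  = []
  sum≡0⇒ (i ∷ is) eq = ℕₚ.m+n≡0⇒m≡0 (f i) eq ∷ sum≡0⇒ is (ℕₚ.m+n≡0⇒n≡0 (f i) eq)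

  sum≡0 : ∀ is → (∀ i → f i ≡ 0) → sum (map f is) ≡ 0
  sum≡0 []       f≡0 = refl
  sum≡0 (i ∷ is) f≡0 = cong₂ _+_ (f≡0 i) (sum≡0 is f≡0)

  sum≤length : ∀ is → (∀ i → f i ≤ 1) → sum (map f is) ≤ length is
  sum≤length []       f≤1 = z≤n
  sum≤length (i ∷ is) f≤1 = ℕₚ.+-mono-≤ (f≤1 i) (sum≤length is f≤1)

  product≤1 : ∀ is → (∀ i → f i ≤ 1) → product (map f is) ≤ 1
  product≤1 []       f≤1 = ℕₚ.≤-refl
  product≤1 (i ∷ is) f≤1 = ℕₚ.*-mono-≤ (f≤1 i) (product≤1 is f≤1)

  product≢0⇒ : ∀ is → product (map f is) ≢ 0 → All (λ i → f i ≢ 0) is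
  product≢0⇒ []       _  = []
  product≢0⇒ (i ∷ is) ≢0 =
    (λ fi≡0 → ≢0 (cong (_* product (map f is)) fi≡0)) ∷
    product≢0⇒ is (λ p≡0 → ≢0 (trans (cong (f i *_) p≡0) (ℕₚ.*-zeroʳ (f i))))

  -- Each nonzero summand is at most 1 and is charged to one surviving element of the filtered list.
  -- The map `g` fits the rows of a cartesian product.
  sum≤count : ∀ {J : Set} {P : J → Set} (P? : Decidable P) (g : I → J) →
    (∀ i → f i ≤ 1) → (∀ i → f i ≢ 0 → P (g i)) →
    ∀ is → sum (map f is) ≤ length (filter P? (map g is))
  sum≤count P? g f≤1 f≢0⇒ []       = z≤n
  sum≤count P? g f≤1 f≢0⇒ (i ∷ is) with P? (g i)
  ... | yes _ = ℕₚ.+-mono-≤ (f≤1 i) (sum≤count P? g f≤1 f≢0⇒ is)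
  ... | no ¬p = subst (λ k → k + sum (map f is) ≤ length (filter P? (map g is)))
    (sym (decidable-stable (f i ℕₚ.≟ 0) (λ f≢0 → ¬p (f≢0⇒ i f≢0)))) (sum≤count P? g f≤1 f≢0⇒ is)

sum²≤count : ∀ {I J : Set} {f : I → J → ℕ} {P : I × J → Set} (P? : Decidable P) →
  (∀ i j → f i j ≤ 1) → (∀ i j → f i j ≢ 0 → P (i , j)) →
  ∀ is js → sum (map (λ i → sum (map (f i) js)) is) ≤ length (filter P? (cartesianProduct is js))
sum²≤count P? f≤1 f≢0⇒ []       js = z≤n
sum²≤count {f = f} P? f≤1 f≢0⇒ (i ∷ is) js = begin
  sum (map (f i) js) + sum (map (λ i → sum (map (f i) js)) is)
    ≤⟨ ℕₚ.+-mono-≤ (sum≤count P? (i ,_) (f≤1 i) (f≢0⇒ i) js) (sum²≤count P? f≤1 f≢0⇒ is js) ⟩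
  length (filter P? (map (i ,_) js)) + length (filter P? (cartesianProduct is js))
    ≡⟨ Listₚ.length-++ (filter P? (map (i ,_) js)) ⟨
  length (filter P? (map (i ,_) js) ++ filter P? (cartesianProduct is js))
    ≡⟨ cong length (Listₚ.filter-++ P? (map (i ,_) js) (cartesianProduct is js)) ⟨
  length (filter P? (map (i ,_) js ++ cartesianProduct is js)) ∎
  where open ℕₚ.≤-Reasoning

-- Counting violated constraints

bit≤1 : ∀ b → bit b ≤ 1
bit≤1 true  = ℕₚ.≤-refl
bit≤1 false = z≤n

bit≢0⇒ : ∀ b → bit b ≢ 0 → b ≡ true
bit≢0⇒ true  _  = refl
bit≢0⇒ false ≢0 = contradiction refl ≢0

*≢0⇒ˡ : ∀ m n → m * n ≢ 0 → m ≢ 0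
*≢0⇒ˡ m n ≢0 m≡0 = ≢0 (cong (_* n) m≡0)

*≢0⇒ʳ : ∀ m n → m * n ≢ 0 → n ≢ 0
*≢0⇒ʳ m n ≢0 n≡0 = ≢0 (trans (cong (m *_) n≡0) (ℕₚ.*-zeroʳ m))

module _ {ℓ n m : ℕ} (r : Fin ℓ → Fin n → Fin n → Fin n) where

  -- A nonzero summand has all factors of `E` nonzero, so its pair is among those counted. The
  -- diagonal is counted as well, which only enlarges the right side.
  W≤pairsInside : (A : Vec (Fin n) m) (x : Input n) → W r A x ≤ pairsInside r (members A)
  -- The decision procedure is local to `pairsInside`, so it is left to unification.
  W≤pairsInside A x = sum²≤count _
    (λ u v → if-elim (_≤ 1) (u Finₚ.≟ v) (λ _ → z≤n)
      (λ _ → ℕₚ.*-mono-≤ (E≤1 u v) (ℕₚ.m∸n≤m 1 (Z {m = m} r x u v))))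
    (λ u v → if-elim (λ k → k ≢ 0 → _) (u Finₚ.≟ v)
      (λ _ 0≢0 → contradiction refl 0≢0)
      (λ _ ≢0 → E≢0⇒ u v (*≢0⇒ˡ (E r A u v) (1 ∸ Z {m = m} r x u v) ≢0)))
    (allFin n) (allFin n)
    where
    E≤1 : ∀ u v → E r A u v ≤ 1
    E≤1 u v = ℕₚ.*-mono-≤ (ℕₚ.*-mono-≤ (bit≤1 (mem A u)) (bit≤1 (mem A v)))
      (product≤1 (allFin ℓ) (λ k → bit≤1 (mem A (r k u v))))

    ∈S : ∀ i → bit (mem A i) ≢ 0 → i ∈ members A
    ∈S i ≢0 = mem⇒∈members A i (bit≢0⇒ (mem A i) ≢0)

    E≢0⇒ : ∀ u v → E r A u v ≢ 0 →
      u ∈ members A × v ∈ members A × (∀ k → r k u v ∈ members A)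
    E≢0⇒ u v ≢0 =
        ∈S u (*≢0⇒ˡ (bit (mem A u)) (bit (mem A v)) uv≢0)
      , ∈S v (*≢0⇒ʳ (bit (mem A u)) (bit (mem A v)) uv≢0)
      , λ k → ∈S (r k u v) (Allₚ.tabulate⁻ (product≢0⇒ (allFin ℓ) (*≢0⇒ʳ uv rs ≢0)) k)
      where
      uv = bit (mem A u) * bit (mem A v)
      rs = product (map (λ k → bit (mem A (r k u v))) (allFin ℓ))
      uv≢0 = *≢0⇒ˡ uv rs ≢0

  -- The indicator that (K) fails at `i`.
  exposed : Input n → Fin n → Vec (Fin n) m → Fin n → ℕ
  exposed x j A i = bit (not (mem A i) ∧ (x i j b₁ ∨ x i j b₂))

  violations : Input n → Fin n → Vec (Fin n) m → ℕ
  violations x j A = sum (map (exposed x j A) (allFin n)) + W r A x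

  violations≤ : ∀ x j A → violations x j A ≤ n + W r A x
  violations≤ x j A = ℕₚ.+-monoˡ-≤ (W r A x) (ℕₚ.≤-trans
    (sum≤length (allFin n) (λ i → bit≤1 (not (mem A i) ∧ (x i j b₁ ∨ x i j b₂))))
    (ℕₚ.≤-reflexive (Listₚ.length-tabulate (λ i → i))))

  valid⇒violations≡0 : ∀ x j A → Valid r x j A → violations x j A ≡ 0
  valid⇒violations≡0 x j A (K , W≡0) = cong₂ _+_
    (sum≡0 (allFin n) (λ i → hidden (mem A i) (x i j b₁) (x i j b₂) (K i))) W≡0
    where
    hidden : ∀ m a b → m ≡ true ⊎ (a ≡ false × b ≡ false) → bit (not m ∧ (a ∨ b)) ≡ 0
    hidden true  _     _     _                = refl
    hidden false false false _                = refl
    hidden false true  _     (inj₂ (() , _))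
    hidden false false true  (inj₂ (_ , ()))

  violations≡0⇒valid : ∀ x j A → violations x j A ≡ 0 → Valid r x j A
  violations≡0⇒valid x j A V≡0 =
      (λ i → unexposed (mem A i) (x i j b₁) (x i j b₂)
        (Allₚ.tabulate⁻ (sum≡0⇒ (allFin n) (ℕₚ.m+n≡0⇒m≡0 (sum (map (exposed x j A) (allFin n))) V≡0)) i))
    , ℕₚ.m+n≡0⇒n≡0 (sum (map (exposed x j A) (allFin n))) V≡0
    where
    unexposed : ∀ m a b → bit (not m ∧ (a ∨ b)) ≡ 0 → m ≡ true ⊎ (a ≡ false × b ≡ false)
    unexposed true  _     _     _ = inj₁ refl
    unexposed false false false _ = inj₂ (refl , refl)

-- Bounds on the list length M.

-- The exponent is a successor so that the default root 0 has power 0.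
floorRoot-^≤ : ∀ k a b → floorRoot (suc k) a b ^ suc k ≤ a
floorRoot-^≤ k a zero    = z≤n
floorRoot-^≤ k a (suc b) = if-elim (λ c → c ^ suc k ≤ a) (suc b ^ suc k ℕₚ.≤? a)
  (λ h → h) (λ _ → floorRoot-^≤ k a b)

floorRoot≤ : ∀ k a b → floorRoot k a b ≤ b
floorRoot≤ k a zero    = z≤n
floorRoot≤ k a (suc b) = if-elim (_≤ suc b) (suc b ^ k ℕₚ.≤? a)
  (λ _ → ℕₚ.≤-refl) (λ _ → ℕₚ.m≤n⇒m≤1+n (floorRoot≤ k a b))

bigM-^≤ : ∀ ℓ → bigM ℓ ^ (ℓ + 2) ≤ size ℓ ^ (ℓ + 1)
bigM-^≤ ℓ = subst (λ k → floorRoot k a (size ℓ) ^ k ≤ a) (ℕₚ.+-comm 2 ℓ)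
  (floorRoot-^≤ (suc ℓ) a (size ℓ))
  where a = size ℓ ^ (ℓ + 1)

-- M ≤ n = 2^ℓ; the strict form needs one more doubling, hence ℓ + 1 probes per search.
bigM<2^ : ∀ ℓ → bigM ℓ < 2 ^ suc ℓ
bigM<2^ ℓ = ℕₚ.≤-<-trans (floorRoot≤ (ℓ + 2) (size ℓ ^ (ℓ + 1)) (size ℓ))
  (ℕₚ.^-monoʳ-< 2 (s≤s (s≤s z≤n)) (ℕₚ.n<1+n ℓ))

-- The approximating polynomial

-- The sequence of `x` is constant, so the rational bounds serve at every index and the tolerance ε
-- is simply added.
within-const : ∀ x b {a} → (∀ n → seq x n ≡ a) → (a ℚ.- bitℚ b ℚ.≤ ⅓) × (ℚ.- ⅓ ℚ.≤ a ℚ.- bitℚ b) →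
               Within (fromℚ ⅓) x (bitℝ b)
within-const x b {a} x≡a (hi , lo) = ≤⅓ , -⅓≤
  where
  diff : ∀ n → seq (x -ℝ bitℝ b) n ≡ a ℚ.- bitℚ b
  diff n = cong₂ ℚ._-_ (x≡a n) (seq-bitℝ b n)

  +ε : ∀ p ε .{{_ : ℚ.Positive ε}} → p ℚ.≤ p ℚ.+ ε
  +ε p ε = ≤-by-gap ε (ℚₚ.<⇒≤ (ℚₚ.positive⁻¹ ε)) refl

  ≤⅓ : x -ℝ bitℝ b ≤ℝ fromℚ ⅓
  ≤⅓ ε = 0 , λ n _ → ℚₚ.≤-trans (subst (ℚ._≤ ⅓) (sym (diff n)) hi) (+ε ⅓ ε)

  -⅓≤ : -ℝ fromℚ ⅓ ≤ℝ x -ℝ bitℝ b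
  -⅓≤ ε = 0 , λ n _ → ℚₚ.≤-trans lo
    (subst (λ p → a ℚ.- bitℚ b ℚ.≤ p ℚ.+ ε) (sym (diff n)) (+ε (a ℚ.- bitℚ b) ε))

-- A membership test reads ℓ + 1 probes and one final entry, each a block of ℓ bits. A summand of
-- `W` makes ℓ + 2 such tests and reads two input bits.
memDegree violationDegree : ℕ → ℕ
memDegree       ℓ = suc ℓ * ℓ + ℓ
violationDegree ℓ = (memDegree ℓ + memDegree ℓ + ℓ * memDegree ℓ) + (1 + 1)

module _ {ℓ : ℕ} (𝒮 : Setup ℓ) where
  open Setup 𝒮

  private
    keyOf : Vec Bool (totalBits ℓ) → Fin (size ℓ)
    keyOf z = decodeBlock 𝒮 z zero

    listOf : Vec Bool (totalBits ℓ) → Vec (Fin (size ℓ)) (bigM ℓ)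
    listOf z = tabulate λ t → decodeBlock 𝒮 z (suc t)

    V : Vec Bool (totalBits ℓ) → ℕ
    V z = violations r (decodeInput ℓ z) (keyOf z) (listOf z)

  block-depth : ∀ t → Depth (λ z → decodeBlock 𝒮 z t) ℓ
  block-depth t = map-depth (Inverse.to name) (lookups-depth λ s → inputBits ℓ ↑ʳ combine t s)

  input-depth : ∀ i j b → Depth (λ z → decodeInput ℓ z i j b) 1
  input-depth i j b = lookup-depth (combine b (combine i j) ↑ˡ descBits ℓ)

  listOf-mem-depth : ∀ i → Depth (λ z → mem (listOf z) i) (memDegree ℓ)
  listOf-mem-depth i = SearchDepth.mem-depth
    (tabulate-entry-depth (λ t → block-depth (suc t))) (suc ℓ) i (bigM<2^ ℓ)

  private
    bit-depth : ∀ i → Depth (λ z → bit (mem (listOf z) i)) (memDegree ℓ)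
    bit-depth i = map-depth bit (listOf-mem-depth i)

  E-depth : ∀ u v → Depth (λ z → E r (listOf z) u v) (memDegree ℓ + memDegree ℓ + ℓ * memDegree ℓ)
  E-depth u v = bind₂ _*_ (bind₂ _*_ (bit-depth u) (bit-depth v))
    (weaken (ℕₚ.≤-reflexive (cong (_* memDegree ℓ) (Listₚ.length-tabulate {n = ℓ} (λ i → i))))
      (product-depth (λ k → bit-depth (r k u v)) (allFin ℓ)))

  W-degree : HasDegree (λ z → ι (W r (listOf z) (decodeInput ℓ z))) (violationDegree ℓ)
  W-degree = sum-degree (λ u → sum-degree (λ v → depth⇒degree ι (term-depth u v)) (allFin _)) (allFin _)
    where
    term-depth : ∀ u v → Depth (λ z → if does (u Finₚ.≟ v) then 0 else
      E r (listOf z) u v * (1 ∸ Z {m = bigM ℓ} r (decodeInput ℓ z) u v)) (violationDegree ℓ)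
    term-depth u v = if-depth (u Finₚ.≟ v) (λ _ → const 0 λ _ → refl) λ _ →
      bind₂ (λ e k → e * (1 ∸ k)) (E-depth u v)
        (bind₂ (λ a b → (1 ∸ bit a) * (1 ∸ bit b)) (input-depth u v b₁) (input-depth v v b₂))

  exposed-depth : ∀ i → Depth (λ z → exposed r (decodeInput ℓ z) (keyOf z) (listOf z) i)
                              (memDegree ℓ + (ℓ + (1 + 1)))
  exposed-depth i = bind₂ (λ m c → bit (not m ∧ c)) (listOf-mem-depth i)
    -- The positions of the two input bits depend on j, so the block naming j is read first.
    (bind (λ j z → decodeInput ℓ z i j b₁ ∨ decodeInput ℓ z i j b₂) (block-depth zero)
      (λ j → bind₂ _∨_ (input-depth i j b₁) (input-depth i j b₂)))

  V-degree : HasDegree (λ z → ι (V z)) (violationDegree ℓ)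
  V-degree = degree-cong (λ z → sym (×-homo-+ 1ℚ
      (sum (map (exposed r (decodeInput ℓ z) (keyOf z) (listOf z)) (allFin _)))
      (W r (listOf z) (decodeInput ℓ z))))
    (+-degree
      (sum-degree (λ i → degree-mono exposed≤ (depth⇒degree ι (exposed-depth i))) (allFin _))
      W-degree)
    where
    exposed≤ : memDegree ℓ + (ℓ + (1 + 1)) ≤ violationDegree ℓ
    exposed≤ = begin
      memDegree ℓ + (ℓ + 2)              ≡⟨ ℕₚ.+-assoc (memDegree ℓ) ℓ 2 ⟨
      memDegree ℓ + ℓ + 2                ≤⟨ ℕₚ.+-monoˡ-≤ 2 (ℕₚ.+-monoʳ-≤ (memDegree ℓ) (ℕₚ.m≤n+m ℓ (suc ℓ * ℓ))) ⟩
      memDegree ℓ + memDegree ℓ + 2      ≤⟨ ℕₚ.+-monoˡ-≤ 2 (ℕₚ.m≤m+n _ (ℓ * memDegree ℓ)) ⟩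
      violationDegree ℓ                  ∎
      where open ℕₚ.≤-Reasoning

  V≤ : ∀ z → V z ≤ size ℓ + bigL ℓ
  V≤ z = ℕₚ.≤-trans (violations≤ r (decodeInput ℓ z) (keyOf z) (listOf z))
    (ℕₚ.+-monoʳ-≤ (size ℓ) (ℕₚ.≤-trans (W≤pairsInside r (listOf z) (decodeInput ℓ z))
      (sparse (members (listOf z))
        (ℕₚ.≤-trans (ℕₚ.^-monoˡ-≤ (ℓ + 2) (∣members∣≤ (listOf z))) (bigM-^≤ ℓ)))))

  close : ∀ {q} → Separates (size ℓ + bigL ℓ) q → ∀ z →
          (q (ι (V z)) ℚ.- bitℚ (φ₀ 𝒮 z) ℚ.≤ ⅓) × (ℚ.- ⅓ ℚ.≤ q (ι (V z)) ℚ.- bitℚ (φ₀ 𝒮 z))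
  close {q} sep z = if-close (valid? r (decodeInput ℓ z) (keyOf z) (listOf z))
    (valid⇒violations≡0 r (decodeInput ℓ z) (keyOf z) (listOf z))
    (violations≡0⇒valid r (decodeInput ℓ z) (keyOf z) (listOf z))
    where
    open Separates sep
    0≤⅓ : 0ℚ ℚ.≤ ⅓
    0≤⅓ = ℚₚ.nonNegative⁻¹ ⅓

    -- Stated for an arbitrary decision, so that `φ₀`, which unfolds to `does` of `valid?`, is
    -- handled by matching on it.
    if-close : ∀ {P : Set} (P? : Dec P) → (P → V z ≡ 0) → (V z ≡ 0 → P) →
      (q (ι (V z)) ℚ.- bitℚ (does P?) ℚ.≤ ⅓) × (ℚ.- ⅓ ℚ.≤ q (ι (V z)) ℚ.- bitℚ (does P?))
    if-close (yes p) P⇒ ⇒P = subst (ℚ._≤ ⅓) (sym gap≡0) 0≤⅓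
                           , subst (ℚ.- ⅓ ℚ.≤_) (sym gap≡0) (ℚₚ.neg-antimono-≤ 0≤⅓)
      where
      gap≡0 : q (ι (V z)) ℚ.- 1ℚ ≡ 0ℚ
      gap≡0 = trans (cong (ℚ._- 1ℚ) (trans (cong (λ k → q (ι k)) (P⇒ p)) at-0)) (ℚₚ.+-inverseʳ 1ℚ)
    if-close (no ¬p) P⇒ ⇒P = subst (ℚ._≤ ⅓) (sym gap≡q) (upper (V z) 1≤V (V≤ z))
                           , subst (ℚ.- ⅓ ℚ.≤_) (sym gap≡q) (lower (V z) 1≤V (V≤ z))
      where
      gap≡q : q (ι (V z)) ℚ.- 0ℚ ≡ q (ι (V z))
      gap≡q = ℚₚ.+-identityʳ (q (ι (V z)))
      1≤V : 1 ≤ V z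
      1≤V = ℕₚ.n≢0⇒n>0 (λ V≡0 → ¬p (⇒P V≡0))

  approximation : ∀ s → size ℓ + bigL ℓ ≤ s * s →
    ∃[ p ] Degree≤ p (s * violationDegree ℓ) × Approximates p (φ₀ 𝒮)
  approximation s m≤s² = poly h , bounded⇒degree≤ (poly h) (bounded h) ,
    λ z → within-const (eval (poly h) (Vec.map bitℝ z)) (φ₀ 𝒮 z) (agrees h z) (close separates z)
    where
    open Separator (size ℓ + bigL ℓ) s
      (ℕₚ.≤-trans (ℕₚ.m^n>0 2 ℓ) (ℕₚ.m≤m+n (size ℓ) (bigL ℓ))) m≤s²
    h = separator-degree V-degree

-- Choice of the Chebyshev degree and the resulting numerical bounds.

-- Induction on `m`, raising `s` only when m = s². Then (s + 1)² = m + 1 + 2s with s ≤ m, for which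
-- the factor 4 leaves room.
∃-sqrt : ∀ m → ∃[ s ] (m ≤ s * s × s * s ≤ 4 * m)
∃-sqrt zero    = 0 , z≤n , z≤n
∃-sqrt (suc m) with ∃-sqrt m
... | s , m≤s² , s²≤4m with suc m ℕₚ.≤? s * s
...   | yes 1+m≤s² = s , 1+m≤s² , ℕₚ.≤-trans s²≤4m (ℕₚ.*-monoʳ-≤ 4 (ℕₚ.n≤1+n m))
...   | no  1+m≰s² = suc s , lower′ , upper′
  where
  open ℕₚ.≤-Reasoning
  open ℕ-Solver
  s²≡m : s * s ≡ m
  s²≡m = ℕₚ.≤-antisym (ℕₚ.≤-pred (ℕₚ.≰⇒> 1+m≰s²)) m≤s²

  [1+s]² : suc s * suc s ≡ suc (s * s) + (s + s)
  [1+s]² = solve 1 (λ s → (con 1 :+ s) :* (con 1 :+ s) := con 1 :+ s :* s :+ (s :+ s)) refl s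

  n≤n² : ∀ n → n ≤ n * n
  n≤n² zero    = z≤n
  n≤n² (suc n) = ℕₚ.m≤m*n (suc n) (suc n)

  s≤m : s ≤ m
  s≤m = ℕₚ.≤-trans (n≤n² s) (ℕₚ.≤-reflexive s²≡m)

  lower′ : suc m ≤ suc s * suc s
  lower′ = begin
    suc m                   ≡⟨ cong suc s²≡m ⟨
    suc (s * s)             ≤⟨ ℕₚ.m≤m+n (suc (s * s)) (s + s) ⟩
    suc (s * s) + (s + s)   ≡⟨ [1+s]² ⟨
    suc s * suc s           ∎

  upper′ : suc s * suc s ≤ 4 * suc m
  upper′ = begin
    suc s * suc s             ≡⟨ [1+s]² ⟩
    suc (s * s) + (s + s)     ≤⟨ ℕₚ.+-mono-≤ (ℕₚ.≤-reflexive (cong suc s²≡m)) (ℕₚ.+-mono-≤ s≤m s≤m) ⟩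
    suc m + (m + m)           ≤⟨ ℕₚ.m≤m+n _ (m + 3) ⟩
    suc m + (m + m) + (m + 3) ≡⟨ solve 1 (λ m → con 1 :+ m :+ (m :+ m) :+ (m :+ con 3) := con 4 :* (con 1 :+ m)) refl m ⟩
    4 * suc m                 ∎

module _ where
  open ℕₚ.≤-Reasoning
  open ℕ-Solver

  -- The left side is ℓ³ + 4ℓ² + 4ℓ + 2, equal to 11 at ℓ = 1. Written in a = ℓ - 1, the difference
  -- `slack` has only nonnegative coefficients.
  violationDegree≤ : ∀ ℓ → 1 ≤ ℓ → violationDegree ℓ ≤ 11 * ℓ ^ 3
  violationDegree≤ (suc a) _ = begin
    violationDegree (suc a)                              ≤⟨ ℕₚ.m≤m+n _ slack ⟩
    violationDegree (suc a) + slack                      ≡⟨ solve 1 (λ a →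
      let ℓ = con 1 :+ a ; D = (con 1 :+ ℓ) :* ℓ :+ ℓ in
      (D :+ D :+ ℓ :* D) :+ con 2 :+ (con 10 :* a :^ 3 :+ con 26 :* a :^ 2 :+ con 18 :* a)
      := con 11 :* ℓ :^ 3) refl a ⟩
    11 * suc a ^ 3                                       ∎
    where slack = 10 * a ^ 3 + 26 * a ^ 2 + 18 * a

  -- The constant arises as 4·11² = 22².
  sqrtBound : ∀ ℓ s m → 1 ≤ ℓ → s * s ≤ 4 * m → SqrtBound (s * violationDegree ℓ) (22 * ℓ ^ 3) m
  sqrtBound ℓ s m 1≤ℓ s²≤4m = begin
    (s * violationDegree ℓ) ^ 2   ≤⟨ ℕₚ.^-monoˡ-≤ 2 (ℕₚ.*-monoʳ-≤ s (violationDegree≤ ℓ 1≤ℓ)) ⟩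
    (s * (11 * c)) ^ 2            ≡⟨ solve 2 (λ s c → (s :* (con 11 :* c)) :^ 2 := (s :* s) :* (con 121 :* c :^ 2)) refl s c ⟩
    (s * s) * (121 * c ^ 2)       ≤⟨ ℕₚ.*-monoˡ-≤ (121 * c ^ 2) s²≤4m ⟩
    (4 * m) * (121 * c ^ 2)       ≡⟨ solve 2 (λ m c → (con 4 :* m) :* (con 121 :* c :^ 2) := (con 22 :* c) :^ 2 :* m) refl m c ⟩
    (22 * c) ^ 2 * m              ∎
    where c = ℓ ^ 3

  -- n + L = (1 + ℓ)n is bounded by (2ℓ)²n; the square lets 2ℓ move into the coefficient, turning
  -- 22ℓ³ into 44ℓ⁴.
  absorbL : ∀ d ℓ → 1 ≤ ℓ → SqrtBound d (22 * ℓ ^ 3) (size ℓ + bigL ℓ) → SqrtBound d (44 * ℓ ^ 4) (size ℓ)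
  absorbL d ℓ 1≤ℓ bound = begin
    d ^ 2                                   ≤⟨ bound ⟩
    (22 * ℓ ^ 3) ^ 2 * (n + ℓ * n)          ≤⟨ ℕₚ.*-monoʳ-≤ ((22 * ℓ ^ 3) ^ 2) n+ℓn≤ ⟩
    (22 * ℓ ^ 3) ^ 2 * (4 * (ℓ * ℓ) * n)    ≡⟨ solve 2 (λ ℓ n → (con 22 :* ℓ :^ 3) :^ 2 :* (con 4 :* (ℓ :* ℓ) :* n)
                                                 := (con 44 :* ℓ :^ 4) :^ 2 :* n) refl ℓ n ⟩
    (44 * ℓ ^ 4) ^ 2 * n                    ∎
    where
    n = size ℓ
    ℓ≤ℓ² : ℓ ≤ ℓ * ℓ
    ℓ≤ℓ² = ℕₚ.≤-trans (ℕₚ.≤-reflexive (sym (ℕₚ.*-identityʳ ℓ))) (ℕₚ.*-monoʳ-≤ ℓ 1≤ℓ)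
    n+ℓn≤ : n + ℓ * n ≤ 4 * (ℓ * ℓ) * n
    n+ℓn≤ = ℕₚ.*-monoˡ-≤ n (begin
      1 + ℓ                                    ≤⟨ ℕₚ.+-mono-≤ (ℕₚ.≤-trans 1≤ℓ ℓ≤ℓ²) ℓ≤ℓ² ⟩
      ℓ * ℓ + ℓ * ℓ                            ≤⟨ ℕₚ.+-monoʳ-≤ (ℓ * ℓ) (ℕₚ.m≤m+n (ℓ * ℓ) _) ⟩
      4 * (ℓ * ℓ)                              ∎)

φ₀-approximation : ∀ {ℓ} (𝒮 : Setup ℓ) → 5 ≤ ℓ →
  ∃[ p ] ∃[ d ]
    Degree≤ p d
    × Approximates p (φ₀ 𝒮)
    × SqrtBound d (22 * ℓ ^ 3) (size ℓ + bigL ℓ)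
    × SqrtBound d (44 * ℓ ^ 4) (size ℓ)
φ₀-approximation {ℓ} 𝒮 5≤ℓ =
  let s , m≤s² , s²≤4m = ∃-sqrt (size ℓ + bigL ℓ)
      p , deg , app    = approximation 𝒮 s m≤s²
      d                = s * violationDegree ℓ
      1≤ℓ              = ℕₚ.≤-trans (s≤s z≤n) 5≤ℓ
      bound            = sqrtBound ℓ s (size ℓ + bigL ℓ) 1≤ℓ s²≤4m
  in p , d , deg , app , bound , absorbL d ℓ 1≤ℓ bound

proposition4p4 : (∃[ C ] ∃[ C′ ] ∃[ k ] ∃[ ℓ₀ ] ∀ (ℓ : ℕ) → 5 ≤ ℓ → ℓ₀ ≤ ℓ → (𝒮 : Setup ℓ) →
    ∃[ p ] ∃[ d ]
    Degree≤ p d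
    × Approximates p (φ₀ 𝒮)
    × SqrtBound d (C * ℓ ^ 3) (size ℓ + bigL ℓ)
    × SqrtBound d (C′ * ℓ ^ k) (size ℓ))
    ×
    (∃[ C ] ∃[ k ] ∃[ ℓ₀ ] ∀ (ℓ : ℕ) → 5 ≤ ℓ → ℓ₀ ≤ ℓ → (𝒮 : Setup ℓ) →
    ∀ d → IsApproxDegree (φ₀ 𝒮) d → SqrtBound d (C * ℓ ^ k) (size ℓ))
proposition4p4 =
  (22 , 44 , 4 , 0 , λ ℓ 5≤ℓ _ 𝒮 → φ₀-approximation 𝒮 5≤ℓ) ,
  -- Leastness puts d below the degree of the constructed polynomial, and squaring preserves this.
  (44 , 4 , 0 , λ ℓ 5≤ℓ _ 𝒮 d (_ , least) →
    let p , d′ , deg , app , _ , bound = φ₀-approximation 𝒮 5≤ℓ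
    in ℕₚ.≤-trans (ℕₚ.^-monoˡ-≤ 2 (least p d′ deg app)) bound)
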